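{- Let $x$ be an odd integer with $x>1$, let $t\ge2$ be an integer, and let $a,b,c\ge0$ be integers with $b+c\ge1$. Let $L=\{1^a,x^b,(tx)^c\}$, a multiset of size $v-1$ where $v=a+b+c+1$, and suppose $v\ge (t+2)x$. Let $q=\lfloor v/x\rfloor$. If $a\ge\omega(x,b+c)$ and $b\ge 2q+tx-2t+1$, then $L$ has a standard linear realization.
   Context: For a positive integer $n$, $K_n$ is the complete graph on vertex set $\{0,\dots,n-1\}$ and the linear length of an edge $\{u,w\}$ is $|u-w|$. A multiset of positive integers of size $n-1$ has a linear realization if some Hamiltonian path in $K_n$ has multiset of linear edge lengths equal to it; it is standard if the path starts at $0$. $\{x_1^{a_1},\dots\}$ denotes the multiset with $x_i$ of multiplicity $a_i$. For integers $z\ge2$, $d\ge0$, $\omega(z,d)$ is the smallest integer $a\ge0$ such that $\{1^a,z^d\}$ has a standard linear realization. -}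

module Defs where

open import Data.Nat using (ℕ; zero; suc; _+_; _*_; _<_; _∸_)
open import Data.Nat.Base using (∣_-_∣)
open import Data.List using (List; []; _∷_; upTo; replicate; _++_)
open import Data.List.Relation.Binary.Permutation.Propositional using (_↭_)
open import Data.Product using (Σ; _×_)
open import Relation.Binary.PropositionalEquality using (_≡_)
open import Relation.Nullary using (¬_)

edgeLengths : List ℕ → List ℕ
edgeLengths []           = []
edgeLengths (u ∷ [])     = []
edgeLengths (u ∷ w ∷ ps) = ∣ u - w ∣ ∷ edgeLengths (w ∷ ps)

IsHamPath : ℕ → List ℕ → Set
IsHamPath n p = p ↭ upTo n

HasStdLinReal : List ℕ → Set
HasStdLinReal L =
  Σ (List ℕ) λ ps →
    IsHamPath (suc (Data.List.length L)) (0 ∷ ps) × (edgeLengths (0 ∷ ps) ↭ L)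

oneZ : ℕ → ℕ → ℕ → List ℕ
oneZ a z d = replicate a 1 ++ replicate d z

IsOmega : ℕ → ℕ → ℕ → Set
IsOmega z d w = HasStdLinReal (oneZ w z d) × (∀ a → a < w → ¬ HasStdLinReal (oneZ a z d))

module Submission where

open import Defs
open import Data.Nat using (ℕ; suc; _+_; _*_; _/_; _≤_; _<_; _≥_; NonZero)
open import Data.Nat using (_%_)
open import Relation.Binary.PropositionalEquality using (_≡_)
open import Data.List using (replicate; _++_)
open import Data.Nat using (zero; _∸_; _⊓_; z≤n; s≤s; s≤s⁻¹; s<s⁻¹; ∣_-_∣; _≟_)
open import Data.Nat.Properties
open import Data.Nat.DivMod using (m≡m%n+[m/n]*n; m%n<n; m*n/n≡m; m*n%n≡0; /-monoˡ-≤)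
open import Data.Nat.Tactic.RingSolver using (solve-∀)
open import Data.List using (List; []; _∷_; map; length; filter; downFrom; upTo)
open import Data.List.Properties using (length-++; map-++; length-downFrom; length-upTo; length-replicate; reverse-upTo; map-∘; map-cong; map-id; ++-identityʳ; ++-assoc; filter-all; filter-none; filter-++; filter-accept; filter-reject)
open import Data.List.Membership.Propositional using (_∈_; _∉_)
open import Data.List.Membership.Propositional.Properties using (∈-∃++; ∈-++⁺ˡ; ∈-++⁺ʳ; ∈-++⁻; ∈-upTo⁻; ∈-upTo⁺)
open import Data.List.Membership.DecPropositional _≟_ using (_∈?_)
open import Data.List.Relation.Binary.Permutation.Propositional using (_↭_; prep; swap; ↭-refl; ↭-sym; ↭-trans; ↭-reflexive; ↭⇒↭ₛ)
open import Data.List.Relation.Binary.Permutation.Propositional.Properties using (++⁺ˡ; ++⁺ʳ; ++-comm; map⁺; ↭-length; All-resp-↭; ∈-resp-↭; filter-↭; ↭-reverse; shift; ++-commutativeMonoid)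
import Data.List.Relation.Binary.Permutation.Setoid.Properties as SetoidPermutation
open import Data.List.Relation.Unary.All as All using (All; []; _∷_)
open import Data.List.Relation.Unary.All.Properties using (applyDownFrom⁺₁; replicate⁺; All¬⇒¬Any; ¬Any⇒All¬)
open import Data.List.Relation.Unary.AllPairs using ([]; _∷_)
open import Data.List.Relation.Unary.Any using (here; there)
open import Data.List.Relation.Unary.Unique.Propositional using (Unique)
open import Data.List.Relation.Unary.Unique.Propositional.Properties using (upTo⁺)
open import Data.Empty using (⊥; ⊥-elim)
open import Data.Product using (Σ; ∃; _×_; _,_; proj₁; proj₂)
open import Data.Sum as Sum using (_⊎_; inj₁; inj₂; [_,_]′)
open import Data.Unit using (⊤; tt)
open import Relation.Binary.PropositionalEquality
open import Relation.Nullary using (¬_; Dec; yes; no)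
import Algebra.Solver.CommutativeMonoid as CMSolver

open CMSolver (++-commutativeMonoid {A = ℕ}) using (solve; _⊕_; _⊜_; id)

-- Arrange the vertices in x columns, the residue classes mod x. A snake running through the columns
-- alternately upwards and downwards uses x - 1 edges of length 1, and inside a column the lengths x
-- and tx act as lengths 1 and t. If two consecutive columns have the same height, any path on
-- the rows from row 0 can be followed in the first column and retraced in the second, so long edges
-- can be placed two at a time; the last column takes an odd remainder. The paths inside a
-- column are again snakes, with t in place of x.
--
-- The snake exists unless the residue of b + c mod x is odd and at least 3. In that case ω(x, b + c) = x:
-- with only x - 1 edges of length 1, every pair {u, u + x} has to be an edge of the path, so
-- whole columns are traversed in one go, and from 0 the path gets stuck before it has seen all columns.
-- With one more edge of length 1 the snake can turn back near its end.

-- Walks with counted edges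

module Construction where

  -- A walk from u that visits V and then stands on w, which is not counted in V;
  -- a and c count the edges of length 1 and y, and all other edges have length x.
  data Walk (x y : ℕ) : ℕ → ℕ → List ℕ → ℕ → ℕ → Set where
    nil  : ∀ {u} → Walk x y u u [] 0 0
    one  : ∀ {u v w V a c} → ∣ u - v ∣ ≡ 1 → Walk x y v w V a c → Walk x y u w (u ∷ V) (suc a) c
    mid  : ∀ {u v w V a c} → ∣ u - v ∣ ≡ x → Walk x y v w V a c → Walk x y u w (u ∷ V) a c
    big  : ∀ {u v w V a c} → ∣ u - v ∣ ≡ y → Walk x y v w V a c → Walk x y u w (u ∷ V) a (suc c)
    perm : ∀ {u w V V′ a c} → V ↭ V′ → Walk x y u w V a c → Walk x y u w V′ a c

  private variable
    x y u u′ v w w′ a a′ c c′ k N t h m q r : ℕ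
    V V′ W W′ : List ℕ

  infixr 5 _⟫_
  _⟫_ : Walk x y u v V a c → Walk x y v w V′ a′ c′ → Walk x y u w (V ++ V′) (a + a′) (c + c′)
  nil      ⟫ q = q
  one d p  ⟫ q = one d (p ⟫ q)
  mid d p  ⟫ q = mid d (p ⟫ q)
  big d p  ⟫ q = big d (p ⟫ q)
  perm σ p ⟫ q = perm (++⁺ʳ _ σ) (p ⟫ q)

  recount : a ≡ a′ → c ≡ c′ → Walk x y u w V a c → Walk x y u w V a′ c′
  recount refl refl p = p

  reaim : u ≡ u′ → w ≡ w′ → Walk x y u w V a c → Walk x y u′ w′ V a c
  reaim refl refl p = p

  snoc : Walk x y u v V a c → Walk x y v w (v ∷ []) a′ c′ → Walk x y u w (v ∷ V) (a′ + a) (c′ + c)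
  snoc {V = V} {a = a} {c = c} {a′ = a′} {c′ = c′} p q = perm (++-comm V _) (recount (+-comm a a′) (+-comm c c′) (p ⟫ q))

  reverseWalk : Walk x y u w V a c → Σ (List ℕ) λ V′ → Walk x y w u V′ a c × u ∷ V′ ↭ w ∷ V
  reverseWalk nil = [] , nil , ↭-refl
  reverseWalk {u = u} {w} (one {v = v} d p) with reverseWalk p
  ... | V′ , p′ , σ = v ∷ V′ , snoc p′ (one (trans (∣-∣-comm v u) d) nil) , ↭-trans (prep u σ) (swap u w ↭-refl)
  reverseWalk {u = u} {w} (mid {v = v} d p) with reverseWalk p
  ... | V′ , p′ , σ = v ∷ V′ , snoc p′ (mid (trans (∣-∣-comm v u) d) nil) , ↭-trans (prep u σ) (swap u w ↭-refl)
  reverseWalk {u = u} {w} (big {v = v} d p) with reverseWalk p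
  ... | V′ , p′ , σ = v ∷ V′ , snoc p′ (big (trans (∣-∣-comm v u) d) nil) , ↭-trans (prep u σ) (swap u w ↭-refl)
  reverseWalk {w = w} (perm σ p) with reverseWalk p
  ... | V′ , p′ , τ = V′ , p′ , ↭-trans τ (prep w σ)

  start-satisfies : ∀ {P : ℕ → Set} → Walk x y u w V a c → All P V → P w → P u
  start-satisfies nil        _        pw = pw
  start-satisfies (one _ _)  (pu ∷ _) _  = pu
  start-satisfies (mid _ _)  (pu ∷ _) _  = pu
  start-satisfies (big _ _)  (pu ∷ _) _  = pu
  start-satisfies (perm σ p) ps       pw = start-satisfies p (All-resp-↭ (↭-sym σ) ps) pw

  module _ {P : ℕ → Set} {f : ℕ → ℕ} (iso : ∀ {u v} → P u → P v → ∣ f u - f v ∣ ≡ ∣ u - v ∣) where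

    -- The isometry is assumed only on `P`, since the reflection `M ∸_` keeps distances only between
    -- numbers up to `M`.
    mapWalk : Walk x y u w V a c → All P V → P w → Walk x y (f u) (f w) (map f V) a c
    mapWalk nil        _         pw = nil
    mapWalk (one d p)  (pu ∷ ps) pw = one (trans (iso pu (start-satisfies p ps pw)) d) (mapWalk p ps pw)
    mapWalk (mid d p)  (pu ∷ ps) pw = mid (trans (iso pu (start-satisfies p ps pw)) d) (mapWalk p ps pw)
    mapWalk (big d p)  (pu ∷ ps) pw = big (trans (iso pu (start-satisfies p ps pw)) d) (mapWalk p ps pw)
    mapWalk (perm σ p) ps        pw = perm (map⁺ f σ) (mapWalk p (All-resp-↭ (↭-sym σ) ps) pw)

  cell : ℕ → ℕ → ℕ → ℕ
  cell x i k = i + k * x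

  ∣cell-cell∣ : ∀ x i k l → ∣ cell x i k - cell x i l ∣ ≡ ∣ k - l ∣ * x
  ∣cell-cell∣ x i k l = trans (∣m+n-m+o∣≡∣n-o∣ i (k * x) (l * x)) (sym (*-distribʳ-∣-∣ x k l))

  scaleWalk : ∀ x i {t} → Walk 1 t u w V 0 c → Walk x (t * x) (cell x i u) (cell x i w) (map (cell x i) V) 0 c
  scaleWalk x i nil = nil
  scaleWalk x i (mid {u} {v} d p) =
    mid (trans (∣cell-cell∣ x i u v) (trans (cong (_* x) d) (*-identityˡ x))) (scaleWalk x i p)
  scaleWalk x i (big {u} {v} d p) = big (trans (∣cell-cell∣ x i u v) (cong (_* x) d)) (scaleWalk x i p)
  scaleWalk x i (perm σ p) = perm (map⁺ _ σ) (scaleWalk x i p)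

  -- This makes the construction recursive. Inside a column the short edges are the uncounted kind
  -- and the long ones the counted kind, so a snake can be reread as a row once `a` is traded for
  -- its complement `m`.
  relabel : Walk x y u w V a 0 → ∃ λ m → Walk 1 x u w V 0 m × m + a ≡ length V
  relabel nil = 0 , nil , refl
  relabel (one {a = a} d p) with relabel p
  ... | m , p′ , e = m , mid d p′ , trans (+-suc m a) (cong suc e)
  relabel (mid d p) with relabel p
  ... | m , p′ , e = suc m , big d p′ , cong suc e
  relabel (perm σ p) with relabel p
  ... | m , p′ , e = m , perm σ p′ , trans e (↭-length σ)

  edgeList : ℕ → ℕ → ℕ → ℕ → ℕ → List ℕ
  edgeList x y a b c = replicate a 1 ++ replicate b x ++ replicate c y

  toPath : Walk x y u w V a c → Σ (List ℕ) λ ps → ∃ λ b →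
    (edgeLengths (u ∷ ps) ↭ edgeList x y a b c) × (u ∷ ps ↭ w ∷ V) × (length V ≡ a + b + c)
  toPath nil = [] , 0 , ↭-refl , ↭-refl , refl
  toPath {u = u} {w} (one {v = v} d p) with toPath p
  ... | ps , b , es , vs , e = v ∷ ps , b
      , ↭-trans (↭-reflexive (cong (_∷ _) d)) (prep 1 es)
      , ↭-trans (prep u vs) (swap u w ↭-refl) , cong suc e
  toPath {x} {y} {u} {w} (mid {v = v} {a = a} {c} d p) with toPath p
  ... | ps , b , es , vs , e = v ∷ ps , suc b
      , ↭-trans (↭-reflexive (cong (_∷ _) d))
          (↭-trans (prep x es) (↭-sym (shift x (replicate a 1) (replicate b x ++ replicate c y))))
      , ↭-trans (prep u vs) (swap u w ↭-refl) , trans (cong suc e) (cong (_+ c) (sym (+-suc a b)))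
  toPath {x} {y} {u} {w} (big {v = v} {a = a} {c} d p) with toPath p
  ... | ps , b , es , vs , e = v ∷ ps , b
      , ↭-trans (↭-reflexive (cong (_∷ _) d))
          (↭-trans (prep y es) (↭-sym (↭-trans
            (++⁺ˡ (replicate a 1) (shift y (replicate b x) (replicate c y)))
            (shift y (replicate a 1) (replicate b x ++ replicate c y)))))
      , ↭-trans (prep u vs) (swap u w ↭-refl) , trans (cong suc e) (sym (+-suc (a + b) c))
  toPath {w = w} (perm σ p) with toPath p
  ... | ps , b , es , vs , e = ps , b , es , ↭-trans vs (prep w σ) , trans (sym (↭-length σ)) e

  -- Coverings, standard paths and realizations

  Covers : ℕ → ℕ → ℕ → List ℕ → ℕ → ℕ → Set
  Covers x y u W a c = Σ ℕ λ e → Σ (List ℕ) λ V → Walk x y u e V a c × e ∷ V ↭ W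

  Std : ℕ → ℕ → ℕ → ℕ → ℕ → Set
  Std x y N a c = Covers x y 0 (downFrom N) a c

  -- A path inside one column of height h, with x as the unit of length.
  Row : ℕ → ℕ → ℕ → Set
  Row t h m = Std 1 t h 0 m

  downFrom↭upTo : ∀ n → downFrom n ↭ upTo n
  downFrom↭upTo n = ↭-trans (↭-reflexive (sym (reverse-upTo n))) (↭-reverse (upTo n))

  length-edgeList : ∀ x y a b c → length (edgeList x y a b c) ≡ a + b + c
  length-edgeList x y a b c = trans (length-++ (replicate a 1)) (trans (cong₂ _+_ (length-replicate a)
      (trans (length-++ (replicate b x)) (cong₂ _+_ (length-replicate b) (length-replicate c)))) (sym (+-assoc a b c)))

  realize : ∀ {x y N a b c} → N ≡ suc (a + b + c) → Std x y N a c → HasStdLinReal (edgeList x y a b c)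
  realize {x} {y} {N} {a} {b} {c} eN (e , V , p , σ) with toPath p
  ... | ps , b′ , es , vs , len = ps
      , subst (λ n → 0 ∷ ps ↭ upTo n) (trans eN (cong suc (sym (length-edgeList x y a b c))))
          (↭-trans vs (↭-trans σ (downFrom↭upTo N)))
      , subst (λ b → edgeLengths (0 ∷ ps) ↭ edgeList x y a b c) b′≡b es
    where
    lenV : suc (length V) ≡ suc (a + b + c)
    lenV = trans (↭-length σ) (trans (length-downFrom N) eN)
    b′≡b : b′ ≡ b
    b′≡b = +-cancelˡ-≡ a b′ b (+-cancelʳ-≡ c (a + b′) (a + b) (trans (sym len) (suc-injective lenV)))

  toRow : ∀ {m} → Std x y N a 0 → N ≡ suc (m + a) → Row x N m
  toRow {x} {N = N} {a} {m} (e , V , p , σ) eN with relabel p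
  ... | m′ , p′ , len = e , V , subst (Walk 1 x 0 e V 0) m′≡m p′ , σ
    where
    m′≡m : m′ ≡ m
    m′≡m = +-cancelʳ-≡ a m′ m (trans len (suc-injective (trans (↭-length σ) (trans (length-downFrom N) eN))))

  downFrom-+ : ∀ m n → downFrom (m + n) ≡ map (n +_) (downFrom m) ++ downFrom n
  downFrom-+ zero    n = refl
  downFrom-+ (suc m) n = cong₂ _∷_ (+-comm m n) (downFrom-+ m n)

  prepend-one : Std x y N a c → Std x y (suc N) (suc a) c
  prepend-one {N = N} (e , V , p , σ) = suc e , 0 ∷ map suc V
    , one refl (mapWalk {P = λ _ → ⊤} (λ _ _ → refl) p (All.universal (λ _ → tt) V) tt)
    , ↭-trans (swap (suc e) 0 ↭-refl) (↭-trans (prep 0 (map⁺ suc σ))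
        (↭-trans (++-comm (0 ∷ []) (map suc (downFrom N)))
          (↭-reflexive (trans (sym (downFrom-+ N 1)) (cong downFrom (+-comm N 1))))))

  prepend-ones : ∀ k → Std x y N a c → Std x y (k + N) (k + a) c
  prepend-ones zero    s = s
  prepend-ones (suc k) s = prepend-one (prepend-ones k s)

  -- Columns

  ∣n-1+n∣≡1 : ∀ n → ∣ n - suc n ∣ ≡ 1
  ∣n-1+n∣≡1 zero    = refl
  ∣n-1+n∣≡1 (suc n) = ∣n-1+n∣≡1 n

  rise : ∀ h → Walk 1 t 0 h (downFrom h) 0 0
  rise zero    = nil
  rise (suc h) = snoc (rise h) (mid (∣n-1+n∣≡1 h) nil)

  simpleRow : ∀ h → Row t (suc h) 0
  simpleRow h = h , downFrom h , rise h , ↭-refl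

  col : ℕ → ℕ → ℕ → List ℕ
  col x i h = map (cell x i) (downFrom h)

  block : ℕ → ℕ → ℕ → ℕ → List ℕ
  block x i zero    h = []
  block x i (suc n) h = col x (n + i) h ++ block x i n h

  block-+ : ∀ x i m n h → block x i (m + n) h ≡ block x (n + i) m h ++ block x i n h
  block-+ x i zero    n h = refl
  block-+ x i (suc m) n h = trans
    (cong₂ _++_ (cong (λ j → col x j h) (+-assoc m n i)) (block-+ x i m n h))
    (sym (++-assoc (col x (m + (n + i)) h) (block x (n + i) m h) (block x i n h)))

  block-top : ∀ x i n h → block x i n (suc h) ↭ map (i + h * x +_) (downFrom n) ++ block x i n h
  block-top x i zero    h = ↭-refl
  block-top x i (suc n) h = ↭-trans
    (↭-reflexive (cong (_∷ (col x (n + i) h ++ block x i n (suc h))) (trans (+-assoc n i (h * x)) (+-comm n (i + h * x)))))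
    (prep (i + h * x + n) (↭-trans (++⁺ˡ (col x (n + i) h) (block-top x i n h))
      (solve 3 (λ p q r → p ⊕ (q ⊕ r) ⊜ q ⊕ (p ⊕ r)) ↭-refl
        (col x (n + i) h) (map (i + h * x +_) (downFrom n)) (block x i n h))))

  block-empty : ∀ x i n → block x i n 0 ≡ []
  block-empty x i zero    = refl
  block-empty x i (suc n) = block-empty x i n

  block-full : ∀ x q → block x 0 x q ↭ downFrom (q * x)
  block-full x zero    = ↭-reflexive (block-empty x 0 x)
  block-full x (suc q) = ↭-trans (block-top x 0 x q)
    (↭-trans (++⁺ˡ _ (block-full x q)) (↭-reflexive (sym (downFrom-+ x (q * x)))))

  -- Division with remainder: the first `r` columns are filled to height `q + 1`, the other `s` to
  -- height `q`. The top cells of consecutive columns are consecutive integers.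
  two-blocks : ∀ r s q → block (s + r) r s q ++ block (s + r) 0 r (suc q) ↭ downFrom (r + q * (s + r))
  two-blocks r s q = ↭-trans (++⁺ˡ (block z r s q) (block-top z 0 r q)) (↭-trans
    (solve 3 (λ p t b → p ⊕ (t ⊕ b) ⊜ t ⊕ (p ⊕ b)) ↭-refl (block z r s q) top (block z 0 r q))
    (↭-trans (++⁺ˡ top (↭-trans (↭-reflexive bs) (block-full z q))) (↭-reflexive (sym (downFrom-+ r (q * z))))))
    where
    z = s + r
    top = map (q * z +_) (downFrom r)
    bs : block z r s q ++ block z 0 r q ≡ block z 0 z q
    bs = sym (trans (block-+ z 0 s r q) (cong (λ j → block z j s q ++ block z 0 r q) (+-identityʳ r)))

  -- The second column carries the reverse of the row path of the first, so it is left at the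
  -- bottom, ready for the next pair.
  pairStep : ∀ x i → Row t h m → Walk x (t * x) i (2 + i) (col x i h ++ col x (1 + i) h) 2 (m + m)
  pairStep x i (e , V , p , σ) with reverseWalk p
  ... | V′ , p′ , σ′ =
    perm (map⁺ (cell x i) σ) (snoc (reaim (+-identityʳ i) refl (scaleWalk x i p)) (one (∣n-1+n∣≡1 (cell x i e)) nil))
    ⟫ perm (map⁺ (cell x (1 + i)) (↭-trans σ′ σ))
        (snoc (scaleWalk x (1 + i) p′) (one (trans (cong (λ j → ∣ j - 2 + i ∣) (+-identityʳ (1 + i))) (∣n-1+n∣≡1 (1 + i))) nil))

  split-≤ : ∀ {s} A B → s ≤ A + B → ∃ λ s₁ → ∃ λ s₂ → s₁ ≤ A × s₂ ≤ B × s ≡ s₁ + s₂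
  split-≤ {s} A B s≤ with ≤-total s A
  ... | inj₁ s≤A = s , 0 , s≤A , z≤n , sym (+-identityʳ s)
  ... | inj₂ A≤s = A , s ∸ A , ≤-refl , m≤n+o⇒m∸n≤o s A s≤ , sym (m+[n∸m]≡n A≤s)

  pairs : ∀ {K} → (∀ m → m ≤ K → Row t h m) →
    ∀ x n i {s} → s ≤ n * K → Walk x (t * x) i (n * 2 + i) (block x i (n * 2) h) (n * 2) (s + s)
  pairs rows x zero    i {zero} z≤n = nil
  pairs {h = h} {K = K} rows x (suc n) i s≤ with split-≤ K (n * K) s≤
  ... | s₁ , s₂ , s₁≤K , s₂≤ , refl = perm
    (solve 3 (λ p q r → p ⊕ (q ⊕ r) ⊜ r ⊕ (q ⊕ p)) ↭-refl
      (block x i (n * 2) h) (col x (n * 2 + i) h) (col x (1 + (n * 2 + i)) h))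
    (recount (+-comm (n * 2) 2) (lemma s₁ s₂)
      (pairs rows x n i s₂≤ ⟫ pairStep x (n * 2 + i) (rows s₁ s₁≤K)))
    where
    lemma : ∀ s₁ s₂ → s₂ + s₂ + (s₁ + s₁) ≡ s₁ + s₂ + (s₁ + s₂)
    lemma = solve-∀

  -- Ends of a snake

  infixr 5 _⟫ᶜ_
  _⟫ᶜ_ : Walk x y u v V a c → Covers x y v W a′ c′ → Covers x y u (V ++ W) (a + a′) (c + c′)
  _⟫ᶜ_ {V = V} p (e , V′ , p′ , σ) = e , V ++ V′ , p ⟫ p′ , ↭-trans (↭-sym (shift e V V′)) (++⁺ˡ V σ)

  permC : W ↭ W′ → Covers x y u W a c → Covers x y u W′ a c
  permC τ (e , V , p , σ) = e , V , p , ↭-trans σ τ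

  recountC : a ≡ a′ → c ≡ c′ → Covers x y u W a c → Covers x y u W a′ c′
  recountC refl refl p = p

  reaimC : u ≡ u′ → Covers x y u W a c → Covers x y u′ W a c
  reaimC refl p = p

  reverseC : Walk x y u w V a c → Covers x y w (w ∷ V) a c
  reverseC {u = u} p with reverseWalk p
  ... | V′ , p′ , σ = u , V′ , p′ , σ

  column : ∀ x i → Row t h m → Covers x (t * x) i (col x i h) 0 m
  column x i (e , V , p , σ) = reaimC (+-identityʳ i) (cell x i e , _ , scaleWalk x i p , map⁺ (cell x i) σ)

  climb : ∀ t x i h → Walk x (t * x) i (cell x i h) (col x i h) 0 0
  climb t x i h = reaim (+-identityʳ i) refl (scaleWalk x i {t} (rise h))

  climbAcross : ∀ t x i h → Walk x (t * x) i (cell x (1 + i) h) (col x i (1 + h)) 1 0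
  climbAcross t x i h = snoc (climb t x i h) (one (∣n-1+n∣≡1 (cell x i h)) nil)

  descend : ∀ t x i h → Covers x (t * x) (cell x i h) (col x i (1 + h)) 0 0
  descend t x i h = reverseC (climb t x i h)

  descendAcross : ∀ t x i h → ∣ i - w ∣ ≡ 1 → Walk x (t * x) (cell x i h) w (col x i (1 + h)) 1 0
  descendAcross t x i h d with reverseWalk (climb t x i h)
  ... | V′ , p , σ = perm σ (snoc p (one d nil))

  lastPair : ∀ x i h → Covers x (1 * x) i (col x i (1 + h) ++ col x (1 + i) (1 + h)) 1 0
  lastPair x i h = climbAcross 1 x i h ⟫ᶜ descend 1 x (1 + i) h

  col-bottom : ∀ x i h → col x i (1 + h) ↭ i ∷ col x (i + x) h
  col-bottom x i zero    = ↭-reflexive (cong (_∷ []) (+-identityʳ i))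
  col-bottom x i (suc h) = ↭-trans
    (↭-reflexive (cong (_∷ col x i (1 + h)) (sym (+-assoc i x (h * x)))))
    (↭-trans (prep (cell x (i + x) h) (col-bottom x i h)) (swap (cell x (i + x) h) i ↭-refl))

  -- Crossing at the bottom, climbing, and coming back at the top costs one edge of length 1 more
  -- than `lastPair`; an even number of columns absorbs an extra edge this way.
  crossFirst : ∀ x i h → Covers x (1 * x) i (col x i (2 + h) ++ col x (1 + i) (2 + h)) 2 0
  crossFirst x i h = permC
    (↭-trans (prep i (++-comm (col x (1 + i) (2 + h)) (col x (i + x) (1 + h))))
      (++⁺ʳ (col x (1 + i) (2 + h)) (↭-sym (col-bottom x i (1 + h)))))
    (one (∣n-1+n∣≡1 i) nil
      ⟫ᶜ snoc (climb 1 x (1 + i) (1 + h)) (one (trans (∣-∣-comm (suc (cell x i (1 + h))) (cell x i (1 + h))) (∣n-1+n∣≡1 (cell x i (1 + h)))) nil)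
      ⟫ᶜ reaimC (+-assoc i x (h * x)) (descend 1 x (i + x) h))

  -- The tail of a snake that has to spend one edge of length 1 more than the number of column
  -- changes requires: it enters the left of two columns at the top, goes down the right one, and
  -- comes back to the rest of the left one.
  Tail : ℕ → ℕ → ℕ → ℕ → ℕ → Set
  Tail t x i q m = Covers x (t * x) (cell x i q) (col x i (1 + q) ++ col x (1 + i) (1 + q)) 2 m

  freeTail : ∀ t x i → Row t q m → Tail t x i q m
  freeTail {q} t x i row = permC (prep (cell x i q) (++-comm (col x (1 + i) (1 + q)) (col x i q)))
    (one (∣n-1+n∣≡1 (cell x i q)) nil
      ⟫ᶜ descendAcross t x (1 + i) q (trans (∣-∣-comm (suc i) i) (∣n-1+n∣≡1 i))
      ⟫ᶜ column x i row)

  -- The lower part of the left column has one row too few for a long edge. The right column has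
  -- enough: the walk jumps from its top to its bottom, climbs to the row below the top and returns
  -- to the left column to descend.
  jumpTail : ∀ t x i → Tail (1 + t) x i (1 + t) 1
  jumpTail t x i = permC
      (prep (cell x i (1 + t)) (solve 3 (λ p q r → p ⊕ (q ⊕ r) ⊜ r ⊕ (p ⊕ q)) ↭-refl
        (cell x (1 + i) (1 + t) ∷ []) (col x (1 + i) (1 + t)) (col x i (1 + t))))
      (one (∣n-1+n∣≡1 (cell x i (1 + t)))
        (big (trans (cong (λ j → ∣ cell x (1 + i) (1 + t) - j ∣) (sym (+-identityʳ (1 + i)))) (∣cell-cell∣ x (1 + i) (1 + t) 0)) nil)
      ⟫ᶜ snoc (climb (1 + t) x (1 + i) t)
           (one (trans (∣-∣-comm (suc (cell x i t)) (cell x i t)) (∣n-1+n∣≡1 (cell x i t))) nil)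
      ⟫ᶜ descend (1 + t) x i t)

  tripleEnd : ∀ {t x i q m} → Tail t x (1 + i) q m →
    Covers x (t * x) i (col x i (1 + q) ++ col x (1 + i) (1 + q) ++ col x (2 + i) (1 + q)) 3 m
  tripleEnd {t} {x} {i} {q} tail = climbAcross t x i q ⟫ᶜ tail

  tallTripleEnd : ∀ {t x i q m} → Tail t x (1 + i) q m →
    Covers x (t * x) i (col x i (2 + q) ++ col x (1 + i) (2 + q) ++ col x (2 + i) (1 + q)) 3 m
  tallTripleEnd {t} {x} {i} {q} tail = climbAcross t x i (1 + q)
    -- The last column is one row lower, so the walk steps down once to the height at which `tail`
    -- can cross.
    ⟫ᶜ mid (trans (∣cell-cell∣ x (1 + i) (1 + q) q) (trans (cong (_* x) (trans (∣-∣-comm (1 + q) q) (∣n-1+n∣≡1 q))) (*-identityˡ x))) nil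
    ⟫ᶜ tail

  -- Snakes

  Rows : ℕ → ℕ → ℕ → Set
  Rows t h K = ∀ m → m ≤ K → Row t h m

  simpleRows : ∀ h → Rows t (1 + h) 0
  simpleRows h zero _ = simpleRow h

  snakeBody : ∀ {K₁ K₂ s₁ s₂ x q a m W} k₁ k₂ → Rows t (1 + q) K₁ → Rows t q K₂ → s₁ ≤ k₁ * K₁ → s₂ ≤ k₂ * K₂ →
    Covers x (t * x) (k₂ * 2 + k₁ * 2) W a m →
    Covers x (t * x) 0 (block x 0 (k₁ * 2) (1 + q) ++ block x (k₁ * 2) (k₂ * 2) q ++ W)
      (k₁ * 2 + (k₂ * 2 + a)) ((s₁ + s₁) + ((s₂ + s₂) + m))
  snakeBody {x = x} k₁ k₂ rows₁ rows₂ s₁≤ s₂≤ end =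
    reaim refl (+-identityʳ (k₁ * 2)) (pairs rows₁ x k₁ 0 s₁≤) ⟫ᶜ pairs rows₂ x k₂ (k₁ * 2) s₂≤ ⟫ᶜ end

  -- First come `k₁` pairs of tall columns, then `k₂` pairs of low ones, and `j` low columns are
  -- left to `end`. The pairing forces an even residue.
  snake : ∀ {K₁ K₂ s₁ s₂ x q a m W} j k₁ k₂ → x ≡ j + k₂ * 2 + k₁ * 2 →
    Rows t (1 + q) K₁ → Rows t q K₂ → s₁ ≤ k₁ * K₁ → s₂ ≤ k₂ * K₂ →
    Covers x (t * x) (k₂ * 2 + k₁ * 2) W a m → W ↭ block x (k₂ * 2 + k₁ * 2) j q →
    Std x (t * x) (k₁ * 2 + q * x) (k₁ * 2 + (k₂ * 2 + a)) ((s₁ + s₁) + ((s₂ + s₂) + m))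
  snake {q = q} {W = W} j k₁ k₂ refl rows₁ rows₂ s₁≤ s₂≤ end σ = permC
    (↭-trans (++⁺ˡ b₁ (++⁺ˡ b₂ σ))
      (↭-trans (solve 3 (λ p q r → p ⊕ (q ⊕ r) ⊜ (r ⊕ q) ⊕ p) ↭-refl b₁ b₂ (block z (k₂ * 2 + k₁ * 2) j q))
        (↭-trans (↭-reflexive (cong (_++ b₁) (sym (block-+ z (k₁ * 2) j (k₂ * 2) q))))
          (two-blocks (k₁ * 2) (j + k₂ * 2) q))))
    (snakeBody k₁ k₂ rows₁ rows₂ s₁≤ s₂≤ end)
    where
    z = j + k₂ * 2 + k₁ * 2
    b₁ = block z 0 (k₁ * 2) (1 + q)
    b₂ = block z (k₁ * 2) (k₂ * 2) q

  snake₁ : ∀ {K₁ K₂ s₁ s₂ x q m} k₁ k₂ → x ≡ 1 + k₂ * 2 + k₁ * 2 →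
    Rows t (1 + q) K₁ → Rows t q K₂ → s₁ ≤ k₁ * K₁ → s₂ ≤ k₂ * K₂ → Row t q m →
    Std x (t * x) (k₁ * 2 + q * x) (k₁ * 2 + (k₂ * 2 + 0)) ((s₁ + s₁) + ((s₂ + s₂) + m))
  snake₁ {x = x} k₁ k₂ x≡ rows₁ rows₂ s₁≤ s₂≤ row = snake 1 k₁ k₂ x≡ rows₁ rows₂ s₁≤ s₂≤
    (column x (k₂ * 2 + k₁ * 2) row) (↭-reflexive (sym (++-identityʳ _)))

  snake₃ : ∀ {K₁ K₂ s₁ s₂ x q m} k₁ k₂ → x ≡ 3 + k₂ * 2 + k₁ * 2 →
    Rows t (2 + q) K₁ → Rows t (1 + q) K₂ → s₁ ≤ k₁ * K₁ → s₂ ≤ k₂ * K₂ →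
    Tail t x (1 + (k₂ * 2 + k₁ * 2)) q m →
    Std x (t * x) (k₁ * 2 + (1 + q) * x) (k₁ * 2 + (k₂ * 2 + 3)) ((s₁ + s₁) + ((s₂ + s₂) + m))
  snake₃ {t} {x = x} {q = q} k₁ k₂ x≡ rows₁ rows₂ s₁≤ s₂≤ tail = snake 3 k₁ k₂ x≡ rows₁ rows₂ s₁≤ s₂≤
    (tripleEnd {t} tail)
    (solve 3 (λ p q r → p ⊕ (q ⊕ r) ⊜ r ⊕ (q ⊕ (p ⊕ id))) ↭-refl (col x i (1 + q)) (col x (1 + i) (1 + q)) (col x (2 + i) (1 + q)))
    where i = k₂ * 2 + k₁ * 2

  -- This is the residue `x - 1`: only the final column is low, so the last three do not have the
  -- equal heights that `snake₃` needs.
  tallSnake₃ : ∀ {K s x q m} k → x ≡ 3 + k * 2 → Rows t (2 + q) K → s ≤ k * K →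
    Tail t x (1 + k * 2) q m →
    Std x (t * x) ((1 + k) * 2 + (1 + q) * x) (k * 2 + 3) ((s + s) + m)
  tallSnake₃ {t} {x = x} {q = q} k refl rows s≤ tail = permC
    (↭-trans (solve 4 (λ b p q r → b ⊕ (p ⊕ (q ⊕ r)) ⊜ (r ⊕ id) ⊕ (q ⊕ (p ⊕ b))) ↭-refl
        (block z 0 (k * 2) (2 + q)) (col z (k * 2) (2 + q)) (col z (1 + k * 2) (2 + q)) (col z (2 + k * 2) (1 + q)))
      (↭-trans (↭-reflexive (cong (λ i → block z (2 + k * 2) 1 (1 + q) ++ col z (1 + i) (2 + q) ++ col z i (2 + q) ++ block z 0 (k * 2) (2 + q)) (sym (+-identityʳ (k * 2)))))
        (two-blocks (2 + k * 2) 1 (1 + q))))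
    (reaim refl (+-identityʳ (k * 2)) (pairs rows z k 0 s≤) ⟫ᶜ tallTripleEnd {t} tail)
    where
    z = 3 + k * 2

  simpleSnake₁ : ∀ {x q} k₁ k₂ → x ≡ 1 + k₂ * 2 + k₁ * 2 → Std x (1 * x) (k₁ * 2 + (1 + q) * x) (k₁ * 2 + (k₂ * 2 + 0)) 0
  simpleSnake₁ {q = q} k₁ k₂ x≡ =
    snake₁ {1} {0} {0} {0} {0} k₁ k₂ x≡ (simpleRows (1 + q)) (simpleRows q) z≤n z≤n (simpleRow q)

  simpleSnake₂ : ∀ {x q a} k₁ k₂ → x ≡ 2 + k₂ * 2 + k₁ * 2 →
    Covers x (1 * x) (k₂ * 2 + k₁ * 2) (col x (k₂ * 2 + k₁ * 2) (1 + q) ++ col x (1 + (k₂ * 2 + k₁ * 2)) (1 + q)) a 0 →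
    Std x (1 * x) (k₁ * 2 + (1 + q) * x) (k₁ * 2 + (k₂ * 2 + a)) 0
  simpleSnake₂ {x} {q} k₁ k₂ x≡ end =
    snake {1} {0} {0} {0} {0} 2 k₁ k₂ x≡ (simpleRows (1 + q)) (simpleRows q) z≤n z≤n end
      (solve 2 (λ p q → p ⊕ q ⊜ q ⊕ (p ⊕ id)) ↭-refl (col x i (1 + q)) (col x (1 + i) (1 + q)))
    where i = k₂ * 2 + k₁ * 2

  simpleSnake₃ : ∀ {x q} k₁ k₂ → x ≡ 3 + k₂ * 2 + k₁ * 2 → Std x (1 * x) (k₁ * 2 + (2 + q) * x) (k₁ * 2 + (k₂ * 2 + 3)) 0
  simpleSnake₃ {x} {q} k₁ k₂ x≡ =
    snake₃ {1} {0} {0} {0} {0} k₁ k₂ x≡ (simpleRows (2 + q)) (simpleRows (1 + q)) z≤n z≤n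
      (freeTail 1 _ _ (simpleRow q))

  simpleTallSnake₃ : ∀ {x q} k → x ≡ 3 + k * 2 → Std x (1 * x) ((1 + k) * 2 + (2 + q) * x) (k * 2 + 3) 0
  simpleTallSnake₃ {x} {q} k x≡ =
    tallSnake₃ {1} {0} {0} k x≡ (simpleRows (2 + q)) z≤n (freeTail 1 _ _ (simpleRow q))

  -- Paths inside a column

  rises-by : v ≡ u + k → ∣ u - v ∣ ≡ k
  rises-by {u = u} {k} refl = ∣m-m+n∣≡n u k

  falls-by : u ≡ v + k → ∣ u - v ∣ ≡ k
  falls-by {u} {v} e = trans (∣-∣-comm u v) (rises-by e)

  slide : ∀ d → Covers x y r W a c → Covers x y (d + r) (map (1 + r +_) (downFrom d) ++ W) (d + a) c
  slide zero    p = p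
  slide {r = r} {W = W} (suc d) p = permC (↭-reflexive (cong (_∷ (map (1 + r +_) (downFrom d) ++ W)) (cong suc (+-comm d r))))
    (one (falls-by (+-comm 1 (d + r))) nil ⟫ᶜ slide d p)

  -- A zigzag from right to left through two rows: each round steps left, goes up by `t`, steps left
  -- and comes down by `t`.
  rungs : ∀ t n → Covers t y (2 + n * 2) (map (2 +_) (downFrom (1 + n * 2)) ++ map (2 + t +_) (downFrom (n * 2))) (n * 2) 0
  rungs t zero    = 2 , [] , nil , ↭-refl
  rungs t (suc n) = permC
    (prep _ (prep _ (solve 3 (λ p q r → p ⊕ (q ⊕ r) ⊜ q ⊕ (p ⊕ r)) ↭-refl
      ((2 + t + (1 + n * 2)) ∷ (2 + t + n * 2) ∷ []) (map (2 +_) (downFrom (1 + n * 2))) (map (2 + t +_) (downFrom (n * 2))))))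
    (one {v = 3 + n * 2} (falls-by {v = 3 + n * 2} (+-comm 1 (3 + n * 2))) (mid {v = 2 + t + (1 + n * 2)} (rises-by (e₁ t (n * 2)))
      (one {v = 2 + t + n * 2} (falls-by {v = 2 + t + n * 2} (e₂ t (n * 2))) (mid (falls-by (e₃ t (n * 2))) nil)))
      ⟫ᶜ rungs t n)
    where
    e₁ : ∀ t k → 2 + t + (1 + k) ≡ 3 + k + t
    e₁ = solve-∀
    e₂ : ∀ t k → 2 + t + (1 + k) ≡ 2 + t + k + 1
    e₂ = solve-∀
    e₃ : ∀ t k → 2 + t + k ≡ 2 + k + t
    e₃ = solve-∀

  lowSnake : ∀ d n → t ≡ d + (2 + n * 2) → Std t y (n * 2 + (2 + t)) t 0
  lowSnake {y = y} d n refl = recountC (e d (n * 2)) refl (permC σ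
    -- Columns 0 and 1 are done first, in the order 0, 1, `t + 1`, `t`; from `t` edges of length 1
    -- run back through the columns with a single cell to the `rungs`.
    (one {v = 1} refl (mid {v = 1 + z} refl (one {v = z} (falls-by (+-comm 1 z)) nil)) ⟫ᶜ slide d (rungs z n)))
    where
    z = d + (2 + n * 2)
    e : ∀ d k → 2 + (d + k) ≡ d + (2 + k)
    e = solve-∀
    A = map (3 + n * 2 +_) (downFrom d)
    B = map (2 +_) (downFrom (1 + n * 2))
    C = map (2 + z +_) (downFrom (n * 2))
    low : downFrom (suc z) ≡ A ++ B ++ 1 ∷ 0 ∷ []
    low = trans (cong downFrom (sym (+-suc d (2 + n * 2)))) (trans (downFrom-+ d (3 + n * 2))
      (cong (A ++_) (trans (cong downFrom (+-comm 2 (1 + n * 2))) (downFrom-+ (1 + n * 2) 2))))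
    all : downFrom (n * 2 + (2 + z)) ≡ C ++ (1 + z) ∷ A ++ B ++ 1 ∷ 0 ∷ []
    all = trans (downFrom-+ (n * 2) (2 + z)) (cong (λ l → C ++ (1 + z) ∷ l) low)
    σ : 0 ∷ 1 ∷ (1 + z) ∷ A ++ B ++ C ↭ downFrom (n * 2 + (2 + z))
    σ = ↭-trans (solve 6 (λ o i t a b c → o ⊕ (i ⊕ (t ⊕ (a ⊕ (b ⊕ c)))) ⊜ c ⊕ (t ⊕ (a ⊕ (b ⊕ (i ⊕ o))))) ↭-refl
      (0 ∷ []) (1 ∷ []) ((1 + z) ∷ []) A B C) (↭-reflexive (sym all))

  halve : ∀ n → ∃ λ k → n ≡ k * 2 ⊎ n ≡ 1 + k * 2
  halve zero = 0 , inj₁ refl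
  halve (suc n) with halve n
  ... | k , inj₁ e = k , inj₂ (cong suc e)
  ... | k , inj₂ e = suc k , inj₁ (cong suc e)

  half-< : ∀ j k → j * 2 < k * 2 → j < k
  half-< j k = *-cancelʳ-< 2 j k

  gap : ∀ {j k} → j ≤ k → ∃ λ d → k ≡ d + j
  gap {j} {k} j≤k = k ∸ j , sym (m∸n+n≡m j≤k)

  -- Unlike `x`, the number `t` can be even. The low columns then pair up as well, and `lastPair`
  -- ends the snake; for odd `t` a single column is left over.
  evenCase : ∀ j Q t → j * 2 < t → Std t (1 * t) (j * 2 + (1 + Q) * t) (t ∸ 1) 0
  evenCase j Q t j<t with halve t
  ... | κ , inj₁ refl with gap (half-< j κ j<t)
  ...   | d , refl = recountC (e d j) refl (simpleSnake₂ j d (e′ d j) (lastPair _ (d * 2 + j * 2) Q))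
    where
    e : ∀ d j → j * 2 + (d * 2 + 1) ≡ (d + suc j) * 2 ∸ 1
    e d j = sym (cong (_∸ 1) (e₀ d j))
      where
      e₀ : ∀ d j → (d + suc j) * 2 ≡ 1 + (j * 2 + (d * 2 + 1))
      e₀ = solve-∀
    e′ : ∀ d j → (d + suc j) * 2 ≡ 2 + d * 2 + j * 2
    e′ = solve-∀
  evenCase j Q t j<t | κ , inj₂ refl with gap (*-cancelʳ-≤ j κ 2 (s≤s⁻¹ j<t))
  ...   | d , refl = recountC (e d j) refl (simpleSnake₁ {q = Q} j d (e′ d j))
    where
    e : ∀ d j → j * 2 + (d * 2 + 0) ≡ (d + j) * 2
    e = solve-∀
    e′ : ∀ d j → 1 + (d + j) * 2 ≡ 1 + d * 2 + j * 2
    e′ = solve-∀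

  oddCase : ∀ j Q t → 1 + j * 2 < t → Std t (1 * t) (2 + j * 2 + (1 + Q) * t) t 0
  oddCase j zero t j<t with gap j<t
  ... | d , t≡ = subst (λ N → Std t (1 * t) N t 0) (e j t) (lowSnake d j t≡)
    where
    e : ∀ j t → j * 2 + (2 + t) ≡ 2 + j * 2 + (1 + 0) * t
    e = solve-∀
  oddCase j (suc Q) t j<t with halve t
  ... | κ , inj₁ refl with gap (*-cancelʳ-≤ (suc j) κ 2 j<t)
  ...   | zero , refl = subst (λ N → Std t′ (1 * t′) N t′ 0) (e j Q) (recountC (e′ j) refl
            (simpleSnake₂ {q = 2 + Q} 0 j (e″ j) (crossFirst _ (j * 2 + 0) (1 + Q))))
    where
    t′ = (1 + j) * 2
    e : ∀ j Q → 0 * 2 + (1 + (2 + Q)) * ((1 + j) * 2) ≡ 2 + j * 2 + (1 + suc Q) * ((1 + j) * 2)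
    e = solve-∀
    e′ : ∀ j → 0 * 2 + (j * 2 + 2) ≡ (1 + j) * 2
    e′ = solve-∀
    e″ : ∀ j → (1 + j) * 2 ≡ 2 + j * 2 + 0 * 2
    e″ = solve-∀
  ...   | suc d , refl = recountC (e′ j d) refl
            (simpleSnake₂ {q = 1 + Q} (suc j) d (e″ j d) (crossFirst _ (d * 2 + suc j * 2) Q))
    where
    e′ : ∀ j d → (1 + j) * 2 + (d * 2 + 2) ≡ (1 + d + suc j) * 2
    e′ = solve-∀
    e″ : ∀ j d → (1 + d + suc j) * 2 ≡ 2 + d * 2 + suc j * 2
    e″ = solve-∀
  oddCase j (suc Q) t j<t | κ , inj₂ refl with gap (half-< j κ (s<s⁻¹ j<t))
  ...   | zero , refl = recountC (e′ j) refl (simpleTallSnake₃ {q = Q} j (e″ j))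
    where
    e′ : ∀ j → j * 2 + 3 ≡ 1 + (0 + suc j) * 2
    e′ = solve-∀
    e″ : ∀ j → 1 + (0 + suc j) * 2 ≡ 3 + j * 2
    e″ = solve-∀
  ...   | suc d , refl = recountC (e′ j d) refl (simpleSnake₃ {q = Q} (suc j) d (e″ j d))
    where
    e′ : ∀ j d → (1 + j) * 2 + (d * 2 + 3) ≡ 1 + (1 + d + suc j) * 2
    e′ = solve-∀
    e″ : ∀ j d → 1 + (1 + d + suc j) * 2 ≡ 3 + d * 2 + suc j * 2
    e″ = solve-∀

  -- When the number of taller columns does not suit a snake from left to right: if there are only
  -- two rows, the columns are visited from right to left; otherwise the extra edge of length 1 is
  -- spent at the end of the snake.
  compact : ∀ m t → 1 ≤ t → Std t (1 * t) (1 + m + t) t 0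
  compact m t@(suc t₀) _ with halve (m % t)
  ... | j , inj₁ r≡ = subst (λ N → Std t (1 * t) N t 0) (cong suc (trans (e j (m / t) t) (cong (_+ t) (sym m≡))))
      (prepend-one (evenCase j (m / t) t (subst (_< t) r≡ (m%n<n m t))))
    where
    m≡ : m ≡ j * 2 + m / t * t
    m≡ = trans (m≡m%n+[m/n]*n m t) (cong (_+ m / t * t) r≡)
    e : ∀ j Q t → j * 2 + (1 + Q) * t ≡ j * 2 + Q * t + t
    e = solve-∀
  ... | j , inj₂ r≡ = subst (λ N → Std t (1 * t) N t 0) (trans (e j (m / t) t) (cong (λ n → suc n + t) (sym m≡)))
      (oddCase j (m / t) t (subst (_< t) r≡ (m%n<n m t)))
    where
    m≡ : m ≡ 1 + j * 2 + m / t * t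
    m≡ = trans (m≡m%n+[m/n]*n m t) (cong (_+ m / t * t) r≡)
    e : ∀ j Q t → 2 + j * 2 + (1 + Q) * t ≡ 1 + (1 + j * 2 + Q * t) + t
    e = solve-∀

  -- Jump from 0 to `t` and count back down to 1. A single long edge thus needs only `t + 1` rows,
  -- one fewer than `compact` asks for.
  oneJump : ∀ t → 1 ≤ t → Std t y (1 + t) (t ∸ 1) 0
  oneJump t@(suc t₀) _ = recountC (+-identityʳ t₀) refl (permC σ
    (mid {v = t₀ + 1} (+-comm t₀ 1) nil ⟫ᶜ slide t₀ (1 , [] , nil , ↭-refl)))
    where
    σ : 0 ∷ map (2 +_) (downFrom t₀) ++ 1 ∷ [] ↭ downFrom (1 + t)
    σ = ↭-trans (solve 3 (λ o b i → o ⊕ (b ⊕ i) ⊜ b ⊕ (i ⊕ o)) ↭-refl (0 ∷ []) (map (2 +_) (downFrom t₀)) (1 ∷ []))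
      (↭-reflexive (sym (trans (cong downFrom (+-comm 2 t₀)) (downFrom-+ t₀ 2))))

  -- Up to `K` long edges fit by `compact`, and one fits even for `K = 0` by `oneJump`. Spare rows
  -- are passed by short edges put in front.
  row : ∀ t K m → 1 ≤ t → m ≤ 1 ⊎ m ≤ K → Row t (1 + t + K) m
  row t K zero          _   _               = simpleRow (t + K)
  row t K (suc (suc m)) _   (inj₁ (s≤s ()))
  row t@(suc t₀) K 1    1≤t (inj₁ _)        =
    toRow (subst (λ N → Std t 0 N (K + t₀) 0) (+-comm K (1 + t)) (prepend-ones K (oneJump t 1≤t))) (cong (λ n → suc (suc n)) (+-comm t₀ K))
  row t K m@(suc _) 1≤t (inj₂ m≤K) with gap m≤K
  ... | d , refl = toRow (subst (λ N → Std t (1 * t) N (d + t) 0) (e₁ d m t) (prepend-ones d (compact m t 1≤t))) (e₂ d m t)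
    where
    e₁ : ∀ d m t → d + (1 + m + t) ≡ 1 + t + (d + m)
    e₁ = solve-∀
    e₂ : ∀ d m t → 1 + t + (d + m) ≡ suc (m + (d + t))
    e₂ = solve-∀

  -- Placing the long edges

  reflect-isometric : ∀ {M u v} → u ≤ M → v ≤ M → ∣ M ∸ u - M ∸ v ∣ ≡ ∣ u - v ∣
  reflect-isometric {M} {u} {v} u≤M v≤M with ≤-total u v
  ... | inj₁ u≤v = trans (falls-by (trans (sym (m∸n+n≡m {M ∸ u} {v ∸ u} (∸-monoˡ-≤ u v≤M)))
        (cong (_+ (v ∸ u)) (trans (∸-+-assoc M u (v ∸ u)) (cong (M ∸_) (m+[n∸m]≡n u≤v))))))
      (sym (m≤n⇒∣m-n∣≡n∸m u≤v))
  ... | inj₂ v≤u = trans (rises-by (trans (sym (m∸n+n≡m {M ∸ v} {u ∸ v} (∸-monoˡ-≤ v u≤M)))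
        (cong (_+ (u ∸ v)) (trans (∸-+-assoc M v (u ∸ v)) (cong (M ∸_) (m+[n∸m]≡n v≤u))))))
      (sym (m≤n⇒∣n-m∣≡n∸m v≤u))

  reflect-downFrom : ∀ n j → map (n + j ∸_) (downFrom (1 + n)) ↭ map (j +_) (downFrom (1 + n))
  reflect-downFrom zero    j = ↭-reflexive (cong (_∷ []) (sym (+-identityʳ j)))
  reflect-downFrom (suc n) j = ↭-trans (↭-reflexive head)
    (↭-trans (prep j (reflect-downFrom n (1 + j)))
      (↭-trans (++-comm (j ∷ []) (map (1 + j +_) (downFrom (1 + n)))) (↭-reflexive (sym tail))))
    where
    head : map (1 + n + j ∸_) (downFrom (2 + n)) ≡ j ∷ map (n + (1 + j) ∸_) (downFrom (1 + n))
    head = cong₂ _∷_ (m+n∸m≡n (1 + n) j) (cong (λ s → map (s ∸_) (downFrom (1 + n))) (sym (+-suc n j)))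
    tail : map (j +_) (downFrom (2 + n)) ≡ map (1 + j +_) (downFrom (1 + n)) ++ j ∷ []
    tail = trans (cong (map (j +_)) (trans (cong downFrom (sym (+-comm (1 + n) 1))) (downFrom-+ (1 + n) 1)))
      (trans (map-++ (j +_) (map suc (downFrom (1 + n))) (0 ∷ []))
        (cong₂ _++_ (trans (sym (map-∘ (downFrom (1 + n)))) (map-cong (λ k → +-suc j k) (downFrom (1 + n))))
          (cong (_∷ []) (+-identityʳ j))))

  reflectC : ∀ M → Covers x y u (downFrom (1 + M)) a c → Covers x y (M ∸ u) (downFrom (1 + M)) a c
  reflectC M (e , V , p , σ) with All-resp-↭ (↭-sym σ) (applyDownFrom⁺₁ (λ k → k) (1 + M) s≤s⁻¹)
  ... | e≤M ∷ V≤M = M ∸ e , map (M ∸_) V , mapWalk {P = _≤ M} reflect-isometric p V≤M e≤M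
    , ↭-trans (map⁺ (M ∸_) σ)
        (↭-trans (↭-reflexive (cong (λ s → map (s ∸_) (downFrom (1 + M))) (sym (+-identityʳ M))))
          (↭-trans (reflect-downFrom M 0) (↭-reflexive (map-id (downFrom (1 + M))))))

  -- Row paths start at the bottom; a column entered at the top uses the mirror image.
  fallingColumn : ∀ {q} x i → Row t (1 + q) m → Covers x (t * x) (cell x i q) (col x i (1 + q)) 0 m
  fallingColumn {q = q} x i row with reflectC q row
  ... | e , V , p , σ = cell x i e , _ , scaleWalk x i p , map⁺ (cell x i) σ

  rows : ∀ t K → 1 ≤ t → Rows t (1 + t + K) K
  rows t K 1≤t m m≤K = row t K m 1≤t (inj₂ m≤K)

  -- The long edges are first used up two at a time in pairs of columns.
  greedy : ∀ {c} S F → c ≤ S + S + F → ∃ λ s → ∃ λ m → s ≤ S × (m ≤ 1 ⊎ m ≤ F) × c ≡ s + s + m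
  greedy {c} S F c≤ with halve c
  ... | h , c≡ with ≤-total h S
  ...   | inj₂ S≤h = S , c ∸ (S + S) , ≤-refl , inj₂ (m≤n+o⇒m∸n≤o c (S + S) c≤) , sym (m+[n∸m]≡n (2S≤c c≡))
    where
    h+h : h * 2 ≡ h + h
    h+h = trans (*-comm h 2) (cong (h +_) (+-identityʳ h))
    2S≤c : c ≡ h * 2 ⊎ c ≡ 1 + h * 2 → S + S ≤ c
    2S≤c (inj₁ refl) = ≤-trans (+-mono-≤ S≤h S≤h) (≤-reflexive (sym h+h))
    2S≤c (inj₂ refl) = m≤n⇒m≤1+n (2S≤c′)
      where
      2S≤c′ : S + S ≤ h * 2
      2S≤c′ = ≤-trans (+-mono-≤ S≤h S≤h) (≤-reflexive (sym h+h))
  greedy {c} S F c≤ | h , inj₁ refl | inj₁ h≤S = h , 0 , h≤S , inj₁ z≤n , e h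
    where
    e : ∀ h → h * 2 ≡ h + h + 0
    e = solve-∀
  greedy {c} S F c≤ | h , inj₂ refl | inj₁ h≤S = h , 1 , h≤S , inj₁ ≤-refl , e h
    where
    e : ∀ h → 1 + h * 2 ≡ h + h + 1
    e = solve-∀

  -- Low columns have height `1 + t + g` and take `g` long edges, tall ones `1 + g`. Pairs count
  -- twice, and the unpaired last column adds `g`.
  evenResidue : ∀ k₁ k₂ t g c → 1 ≤ t → c ≤ (k₁ * (1 + g) + k₂ * g) + (k₁ * (1 + g) + k₂ * g) + g →
    Std (1 + (k₁ + k₂) * 2) (t * (1 + (k₁ + k₂) * 2)) (k₁ * 2 + (1 + t + g) * (1 + (k₁ + k₂) * 2)) ((k₁ + k₂) * 2) c
  evenResidue k₁ k₂ t g c 1≤t c≤ with greedy (k₁ * (1 + g) + k₂ * g) g c≤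
  ... | s , m , s≤ , m≤ , c≡ with split-≤ (k₁ * (1 + g)) (k₂ * g) s≤
  ...   | s₁ , s₂ , s₁≤ , s₂≤ , refl = recountC (e k₁ k₂) (trans (e′ s₁ s₂ m) (sym c≡))
    (snake₁ {K₁ = 1 + g} {g} {s₁} {s₂} k₁ k₂ (e″ k₁ k₂)
      (subst (λ h → Rows t h (1 + g)) (+-suc (1 + t) g) (rows t (1 + g) 1≤t)) (rows t g 1≤t) s₁≤ s₂≤ (row t g m 1≤t m≤))
    where
    e : ∀ k₁ k₂ → k₁ * 2 + (k₂ * 2 + 0) ≡ (k₁ + k₂) * 2
    e = solve-∀
    e′ : ∀ s₁ s₂ m → s₁ + s₁ + (s₂ + s₂ + m) ≡ s₁ + s₂ + (s₁ + s₂) + m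
    e′ = solve-∀
    e″ : ∀ k₁ k₂ → 1 + (k₁ + k₂) * 2 ≡ 1 + k₂ * 2 + k₁ * 2
    e″ = solve-∀

  -- For v = 1 + qx the path is built backwards from the top of column 0 and then reflected.
  residueOne : ∀ k t g c → 1 ≤ t → c ≤ k * g + k * g + g →
    Std (3 + k * 2) (t * (3 + k * 2)) (1 + (1 + t + g) * (3 + k * 2)) (2 + k * 2) c
  residueOne k t g c 1≤t c≤ with greedy (k * g) g c≤
  ... | s , m , s≤ , m≤ , refl = reaimC (n∸n≡0 (H * z)) (reflectC (H * z) (recountC (e (k * 2)) refl (permC σ
      -- Column 0 is the only tall one; its top `H * z` is the largest vertex, which the reflection
      -- takes to 0.
      (descendAcross t z 0 H refl
        ⟫ᶜ pairs (rows t g 1≤t) z k 1 s≤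
        ⟫ᶜ climbAcross t z i (t + g)
        ⟫ᶜ fallingColumn z (1 + i) (row t g m 1≤t m≤)))))
    where
    H = 1 + t + g
    z = 3 + k * 2
    i = k * 2 + 1
    e : ∀ n → 1 + (n + (1 + 0)) ≡ 2 + n
    e = solve-∀
    σ = ↭-trans (solve 4 (λ a b c d → a ⊕ (b ⊕ (c ⊕ d)) ⊜ (d ⊕ (c ⊕ b)) ⊕ (a ⊕ id)) ↭-refl
          (col z 0 (1 + H)) (block z 1 (k * 2) H) (col z i H) (col z (1 + i) H))
        (subst (λ x → block x 1 (2 + k * 2) H ++ block x 0 1 (1 + H) ↭ downFrom (1 + H * x)) (+-comm (2 + k * 2) 1)
          (two-blocks 1 (2 + k * 2) H))

  -- In `freeTail` the row path has only `t + g` rows, one fewer than a low column, so the capacity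
  -- drops to `g - 1`. For `g = 0` a single long edge goes through `jumpTail`.
  tail : ∀ t x i g m → 1 ≤ t → m ≤ 1 ⊎ m ≤ g ∸ 1 → Tail t x i (t + g) m
  tail t@(suc t₀) x i zero zero _ _ =
    subst (λ q → Tail t x i q 0) (sym (+-identityʳ t)) (freeTail t x i (simpleRow t₀))
  tail (suc t₀) x i zero 1 _ _ =
    subst (λ q → Tail (suc t₀) x i q 1) (sym (+-identityʳ (suc t₀))) (jumpTail t₀ x i)
  tail t x i zero (suc (suc m)) 1≤t (inj₁ (s≤s ()))
  tail t x i (suc g) m 1≤t m≤ = freeTail t x i (subst (λ h → Row t h m) (sym (+-suc t g)) (row t g m 1≤t m≤))

  -- The name refers to the residue of `b + c`. The extra edge of length 1 adds a vertex, so the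
  -- number of tall columns is even again.
  oddResidue : ∀ k₁ k₂ t g c → 1 ≤ t → c ≤ (k₁ * (1 + g) + k₂ * g) + (k₁ * (1 + g) + k₂ * g) + (g ∸ 1) →
    Std (3 + (k₁ + k₂) * 2) (t * (3 + (k₁ + k₂) * 2)) (k₁ * 2 + (1 + t + g) * (3 + (k₁ + k₂) * 2)) (3 + (k₁ + k₂) * 2) c
  oddResidue k₁ k₂ t g c 1≤t c≤ with greedy (k₁ * (1 + g) + k₂ * g) (g ∸ 1) c≤
  ... | s , m , s≤ , m≤ , c≡ with split-≤ (k₁ * (1 + g)) (k₂ * g) s≤
  ...   | s₁ , s₂ , s₁≤ , s₂≤ , refl = recountC (e k₁ k₂) (trans (e′ s₁ s₂ m) (sym c≡))
    (snake₃ {t} {K₁ = 1 + g} {g} {s₁} {s₂} k₁ k₂ (e″ k₁ k₂)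
      (subst (λ h → Rows t h (1 + g)) (+-suc (1 + t) g) (rows t (1 + g) 1≤t)) (rows t g 1≤t) s₁≤ s₂≤ (tail t _ _ g m 1≤t m≤))
    where
    e : ∀ k₁ k₂ → k₁ * 2 + (k₂ * 2 + 3) ≡ 3 + (k₁ + k₂) * 2
    e = solve-∀
    e′ : ∀ s₁ s₂ m → s₁ + s₁ + (s₂ + s₂ + m) ≡ s₁ + s₂ + (s₁ + s₂) + m
    e′ = solve-∀
    e″ : ∀ k₁ k₂ → 3 + (k₁ + k₂) * 2 ≡ 3 + k₂ * 2 + k₁ * 2
    e″ = solve-∀

  topResidue : ∀ k t g c → 1 ≤ t → c ≤ k * (1 + g) + k * (1 + g) + (g ∸ 1) →
    Std (3 + k * 2) (t * (3 + k * 2)) (2 + k * 2 + (1 + t + g) * (3 + k * 2)) (3 + k * 2) c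
  topResidue k t g c 1≤t c≤ with greedy (k * (1 + g)) (g ∸ 1) c≤
  ... | s , m , s≤ , m≤ , refl = recountC (+-comm (k * 2) 3) refl
    (tallSnake₃ {t} {1 + g} k refl (subst (λ h → Rows t h (1 + g)) (+-suc (1 + t) g) (rows t (1 + g) 1≤t)) s≤
      (tail t _ _ g m 1≤t m≤))

open Construction

-- Counting the room for long edges

cancel-≤ : ∀ {A B C D} K J → A ≡ C + K + J → B ≡ D + K → A ≤ B → C ≤ D
cancel-≤ {C = C} {D} K J refl refl A≤B = +-cancelʳ-≤ K C D (≤-trans (m≤m+n (C + K) J) A≤B)

-- The premise on `b` with `c` added on both sides, where `b + c = ρ + Q * x`, and `q` is replaced
-- by its lower bound `1 + Q`.
Budget : ℕ → ℕ → ℕ → ℕ → ℕ → Set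
Budget x t Q ρ c = 2 * (1 + Q) + t * x + 1 + c ≤ ρ + Q * x + 2 * t

-- A low column has height `1 + Q` and must have room for a long edge. If `t` were `1 + e + Q`, the
-- budget would give `1 + x + e * x ≤ ρ + 2 * e`, against `ρ < x` and `2 ≤ x`.
t≤Q : ∀ x t Q ρ c → 2 ≤ x → ρ < x → Budget x t Q ρ c → t ≤ Q
t≤Q x t Q ρ c 2≤x ρ<x h with ≤-total t Q
... | inj₁ t≤Q = t≤Q
... | inj₂ Q≤t with gap Q≤t
...   | zero , refl = ≤-refl
...   | suc e , refl = ⊥-elim (n≮n (x + e * x) (≤-trans
          (cancel-≤ {C = 1 + (x + e * x)} (2 * Q + Q * x + 2) c (e₁ x Q e c) (e₂ x Q e ρ) h)
          (+-mono-≤ (<⇒≤ ρ<x) (*-monoʳ-≤ e 2≤x))))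
  where
  e₁ : ∀ x Q e c → 2 * (1 + Q) + (1 + e + Q) * x + 1 + c ≡ 1 + (x + e * x) + (2 * Q + Q * x + 2) + c
  e₁ = solve-∀
  e₂ : ∀ x Q e ρ → ρ + Q * x + 2 * (1 + e + Q) ≡ ρ + e * 2 + (2 * Q + Q * x + 2)
  e₂ = solve-∀

surplus : ∀ x t g ρ c → Budget x t (g + t) ρ c → 3 + 2 * g + c ≤ ρ + g * x
surplus x t g ρ c = cancel-≤ (t * x + 2 * t) 0 (e₁ x t g c) (e₂ x t g ρ)
  where
  e₁ : ∀ x t g c → 2 * (1 + (g + t)) + t * x + 1 + c ≡ 3 + 2 * g + c + (t * x + 2 * t) + 0
  e₁ = solve-∀
  e₂ : ∀ x t g ρ → ρ + (g + t) * x + 2 * t ≡ ρ + g * x + (t * x + 2 * t)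
  e₂ = solve-∀

-- In the situation of the theorem these residues of `b + c` have `ω = x - 1`, and the `Tight` ones
-- have `ω = x`.
Slack : ℕ → Set
Slack ρ = (∃ λ j → ρ ≡ j * 2) ⊎ ρ ≡ 1

Tight : ℕ → Set
Tight ρ = ∃ λ j → ρ ≡ 3 + j * 2

slack-or-tight : ∀ ρ → Slack ρ ⊎ Tight ρ
slack-or-tight ρ with halve ρ
... | j     , inj₁ e    = inj₁ (inj₁ (j , e))
... | zero  , inj₂ refl = inj₁ (inj₂ refl)
... | suc j , inj₂ refl = inj₂ (j , refl)

-- Each case of the construction can place every number of long edges up to some C that satisfies
-- the premise.
Room : ℕ → ℕ → ℕ → ℕ → Set
Room x g ρ c = ∀ C → ρ + g * x ≤ C + (3 + 2 * g) → c ≤ C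

budget-room : ∀ x t g ρ c → Budget x t (g + t) ρ c → Room x g ρ c
budget-room x t g ρ c h C le = +-cancelˡ-≤ (3 + 2 * g) c C (≤-trans (surplus x t g ρ c h) (≤-trans le (≤-reflexive (+-comm C (3 + 2 * g)))))

-- For even `ρ` the capacity is `ρ + g * x`. For `ρ = 1` it is `2 * k * g + g`, which meets the
-- bound in `Room` with 2 to spare.
slackStd : ∀ k t g ρ c → let x = 3 + k * 2 in 1 ≤ t → ρ < x → Room x g ρ c → Slack ρ →
  Std x (t * x) (ρ + (g + t) * x + x) (2 + k * 2) c
slackStd k t g ρ c 1≤t ρ<x room (inj₁ (j , refl)) with gap (*-cancelʳ-≤ j (1 + k) 2 (s≤s⁻¹ ρ<x))
... | d , 1+k≡ = subst₂ (λ N a → Std x (t * x) N a c) (e j t g x) (cong (_* 2) k′≡)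
    (subst (λ x → Std x (t * x) (j * 2 + (1 + t + g) * x) ((j + d) * 2) c) x≡
      (evenResidue j d t g c 1≤t (room _ (≤-trans (≤-reflexive (cong (λ x → j * 2 + g * x) (sym x≡))) (≤-trans (m≤m+n _ (3 + 2 * g)) (≤-reflexive (e₂ j d g)))))))
  where
  x = 3 + k * 2
  k′≡ : j + d ≡ 1 + k
  k′≡ = trans (+-comm j d) (sym 1+k≡)
  x≡ : 1 + (j + d) * 2 ≡ x
  x≡ = cong (λ k → 1 + k * 2) k′≡
  e : ∀ j t g x → j * 2 + (1 + t + g) * x ≡ j * 2 + (g + t) * x + x
  e = solve-∀
  e₂ : ∀ j d g → j * 2 + g * (1 + (j + d) * 2) + (3 + 2 * g) ≡
    j * (1 + g) + d * g + (j * (1 + g) + d * g) + g + (3 + 2 * g)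
  e₂ = solve-∀
slackStd k t g ρ c 1≤t ρ<x room (inj₂ refl) = subst (λ N → Std x (t * x) N (2 + k * 2) c) (e t g x)
  (residueOne k t g c 1≤t (room _ (≤-trans (m≤m+n _ 2) (≤-reflexive (e₂ k g)))))
  where
  x = 3 + k * 2
  e : ∀ t g x → 1 + (1 + t + g) * x ≡ 1 + (g + t) * x + x
  e = solve-∀
  e₂ : ∀ k g → 1 + g * (3 + k * 2) + 2 ≡ k * g + k * g + g + (3 + 2 * g)
  e₂ = solve-∀

-- The vertex number has the even residue `ρ + 1`; `topResidue` handles `ρ + 1 = x - 1`, and
-- `oddResidue` the smaller values.
tightStd : ∀ k t g ρ c → let x = 3 + k * 2 in 1 ≤ t → ρ < x → Room x g ρ c → Tight ρ →
  Std x (t * x) (1 + (ρ + (g + t) * x + x)) x c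
tightStd k t g ρ c 1≤t ρ<x room (j , refl) with gap (half-< j k (+-cancelˡ-< 3 (j * 2) (k * 2) ρ<x))
... | zero , refl = subst (λ N → Std x (t * x) N x c) (e j t g x)
  (topResidue (suc j) t g c 1≤t (room _ bound))
  where
  x = 3 + suc j * 2
  A = 3 + 2 * j + 4 * g + 2 * j * g
  e : ∀ j t g x → 2 + suc j * 2 + (1 + t + g) * x ≡ 1 + (3 + j * 2 + (g + t) * x + x)
  e = solve-∀
  e₁ : ∀ j g → 3 + j * 2 + g * (3 + (1 + j) * 2) ≡ 3 + 2 * j + 4 * g + 2 * j * g + g
  e₁ = solve-∀
  e₂ : ∀ j g p → (1 + j) * (1 + g) + (1 + j) * (1 + g) + p + (3 + 2 * g) ≡ 3 + 2 * j + 4 * g + 2 * j * g + (1 + p) + 1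
  e₂ = solve-∀
  bound : 3 + j * 2 + g * x ≤ suc j * (1 + g) + suc j * (1 + g) + (g ∸ 1) + (3 + 2 * g)
  -- `g ≤ 1 + (g ∸ 1)` holds for `g = 0` too, so the truncated subtraction does no harm.
  bound = ≤-trans (≤-reflexive (e₁ j g)) (≤-trans (+-monoʳ-≤ A (m≤n+m∸n g 1))
    (≤-trans (m≤m+n _ 1) (≤-reflexive (sym (e₂ j g (g ∸ 1))))))
... | suc d , refl = subst₂ (λ N x → Std x (t * x) N x c) (trans (cong (λ x → (2 + j) * 2 + (1 + t + g) * x) x≡) (e j t g x)) x≡
  (oddResidue (2 + j) d t g c 1≤t (room _ bound))
  where
  x = 3 + (1 + d + suc j) * 2
  A = 3 + 2 * j + 6 * g + 2 * j * g + 2 * d * g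
  x≡′ : ∀ j d → 3 + (2 + j + d) * 2 ≡ 3 + (1 + d + suc j) * 2
  x≡′ = solve-∀
  x≡ : 3 + (2 + j + d) * 2 ≡ x
  x≡ = x≡′ j d
  e : ∀ j t g x → (2 + j) * 2 + (1 + t + g) * x ≡ 1 + (3 + j * 2 + (g + t) * x + x)
  e = solve-∀
  e₁ : ∀ j d g → 3 + j * 2 + g * (3 + (1 + d + suc j) * 2) ≡ 3 + 2 * j + 6 * g + 2 * j * g + 2 * d * g + g
  e₁ = solve-∀
  e₂ : ∀ j d g p → (2 + j) * (1 + g) + d * g + ((2 + j) * (1 + g) + d * g) + p + (3 + 2 * g)
    ≡ 3 + 2 * j + 6 * g + 2 * j * g + 2 * d * g + (1 + p) + 3
  e₂ = solve-∀
  bound : 3 + j * 2 + g * x ≤ (2 + j) * (1 + g) + d * g + ((2 + j) * (1 + g) + d * g) + (g ∸ 1) + (3 + 2 * g)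
  bound = ≤-trans (≤-reflexive (e₁ j d g)) (≤-trans (+-monoʳ-≤ A (m≤n+m∸n g 1))
    (≤-trans (m≤m+n _ 3) (≤-reflexive (sym (e₂ j d g (g ∸ 1))))))

-- The lower bound for ω

Neighbours : ℕ → ℕ → Set
Neighbours u w = w ≡ suc u ⊎ u ≡ suc w

not-both : ∀ {x u w} → 2 ≤ x → Neighbours u w → ¬ w ≡ u + x
not-both {x} {u} 2≤x (inj₁ refl) e with +-cancelˡ-≡ u 1 x (trans (+-comm u 1) e)
... | refl = n≮n 1 2≤x
not-both {x} {w = w} _ (inj₂ refl) e = m≢1+m+n w e

-- The successor relation of a Hamiltonian path on {0,…,N-1} that starts at 0, has edges of lengths
-- 1 and x only, and uses every pair of vertices at distance x.
record Succession (x N : ℕ) : Set₁ where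
  field
    Next       : ℕ → ℕ → Set
    functional : ∀ {u w w′} → Next u w → Next u w′ → w ≡ w′
    injective  : ∀ {u u′ w} → Next u w → Next u′ w → u ≡ u′
    initial    : ∀ {u} → ¬ Next u 0
    bounded    : ∀ {u w} → Next u w → w < N
    lengths    : ∀ {u w} → Next u w → Neighbours u w ⊎ (w ≡ u + x ⊎ u ≡ w + x)
    saturated  : ∀ u → u + x < N → Next u (u + x) ⊎ Next (u + x) u
    induction  : ∀ (P : ℕ → Set) → P 0 → (∀ {u w} → Next u w → P u → P w) → ∀ {w} → w < N → P w

module _ {x N : ℕ} (2≤x : 2 ≤ x) (S : Succession x N) where
  open Succession S

  cell-suc : ∀ j k → cell x j (suc k) ≡ cell x j k + x
  cell-suc j k = trans (cong (j +_) (+-comm x (k * x))) (sym (+-assoc j (k * x) x))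

  skip : ∀ j k → ¬ cell x j k ≡ cell x j (2 + k)
  skip j k e = m+1+n≢m (cell x j k) {x ∸ 1 + x} (trans (lemma x 2≤x) (sym e))
    where
    lemma : ∀ x → 2 ≤ x → j + k * x + suc (x ∸ 1 + x) ≡ j + (x + (x + k * x))
    lemma (suc y) _ = eq j k y
      where
      eq : ∀ j k y → j + k * suc y + suc (y + suc y) ≡ j + (suc y + (suc y + k * suc y))
      eq = solve-∀

  column-edge : ∀ j k → cell x j (suc k) < N →
    Next (cell x j k) (cell x j (suc k)) ⊎ Next (cell x j (suc k)) (cell x j k)
  column-edge j k lt rewrite cell-suc j k = saturated (cell x j k) lt

  ¬up : ∀ {j k w} → Neighbours (cell x j k) w → ¬ w ≡ cell x j (suc k)
  ¬up {j} {k} nb e = not-both 2≤x nb (trans e (cell-suc j k))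

  ¬down : ∀ {j k w} → Neighbours (cell x j (suc k)) w → ¬ w ≡ cell x j k
  ¬down {j} {k} nb e = not-both 2≤x (flip nb) (trans (cell-suc j k) (cong (_+ x) (sym e)))
    where
    flip : ∀ {u w} → Neighbours u w → Neighbours w u
    flip (inj₁ e) = inj₂ e
    flip (inj₂ e) = inj₁ e

  ¬from-above : ∀ {j k u} → Neighbours u (cell x j k) → ¬ u ≡ cell x j (suc k)
  ¬from-above {j} {k} nb refl = ¬down {j} {k} nb refl

  ¬from-below : ∀ {j k u} → Neighbours u (cell x j (suc k)) → ¬ u ≡ cell x j k
  ¬from-below {j} {k} nb refl = ¬up {j} {k} nb refl

  -- Columns lo, …, lo + 2n of height T + 2, with no path edge leaving the corners at the top. The path
  -- is forced to run through these columns alternately upwards and downwards, so once inside it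
  -- never gets out.
  module Rectangle (lo n T : ℕ) (hi≤x : n * 2 + lo ≤ x)
    (inside : ∀ {j k} → lo ≤ j → j ≤ n * 2 + lo → k ≤ suc T → cell x j k < N)
    (outside : ∀ {j k} → lo ≤ j → j ≤ n * 2 + lo → cell x j k < N → k ≤ suc T)
    (rightExit : ¬ Next (cell x (n * 2 + lo) (suc T)) (suc (cell x (n * 2 + lo) (suc T))))
    (leftExit : ∀ {w} → Next (cell x lo (suc T)) w → ¬ cell x lo (suc T) ≡ suc w) where

    L : ℕ → ℕ
    L e = e * 2 + lo

    Up Down : ℕ → Set
    Up j = ∀ {k} → k < suc T → Next (cell x j k) (cell x j (suc k))
    Down j = ∀ {k} → k < suc T → Next (cell x j (suc k)) (cell x j k)

    -- The invariant: counted from `lo`, columns at even distance are run upwards, those at odd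
    -- distance downwards. Both outermost columns go upwards, so the sides could be left only at the
    -- top corners.
    data Visited : ℕ → Set where
      up   : ∀ {e k} → e ≤ n → k ≤ suc T → Up (L e) → Visited (cell x (L e) k)
      down : ∀ {e k} → e < n → k ≤ suc T → Down (suc (L e)) → Visited (cell x (suc (L e)) k)

    lo≤L : ∀ e → lo ≤ L e
    lo≤L e = m≤n+m lo (e * 2)

    L≤ : ∀ {e} → e ≤ n → L e ≤ n * 2 + lo
    L≤ e≤n = +-monoˡ-≤ lo (*-monoˡ-≤ 2 e≤n)

    1+L≤ : ∀ {e} → e < n → suc (L e) ≤ n * 2 + lo
    1+L≤ e<n = ≤-trans (n≤1+n _) (L≤ e<n)

    -- The next vertical pair is an edge too. Run downwards, it would give the cell in the middle
    -- two predecessors, which `skip` keeps apart.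
    climbs : ∀ {j} → lo ≤ j → j ≤ n * 2 + lo → Next (cell x j 0) (cell x j 1) → Up j
    climbs lo≤j j≤ first {zero} _ = first
    climbs {j} lo≤j j≤ first {suc k} lt with column-edge j (suc k) (inside lo≤j j≤ lt)
    ... | inj₁ n = n
    ... | inj₂ n = ⊥-elim (skip j k (injective (climbs lo≤j j≤ first (<-trans (n<1+n k) lt)) n))

    falls : ∀ {j} → lo ≤ j → j ≤ n * 2 + lo → Next (cell x j (suc T)) (cell x j T) → Down j
    falls {j} lo≤j j≤ first {k} k<1+T with gap (s≤s⁻¹ k<1+T)
    ... | d , T≡ = go d k T≡
      where
      go : ∀ d k → T ≡ d + k → Next (cell x j (suc k)) (cell x j k)
      go zero    k refl = first
      go (suc d) k T≡ with column-edge j k (inside lo≤j j≤ (s≤s (subst (k ≤_) (sym T≡) (m≤n+m k (suc d)))))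
      ... | inj₂ n = n
      ... | inj₁ n = ⊥-elim (skip j k (injective n (go d (suc k) (trans T≡ (sym (+-suc d k))))))

    enterBottom : ∀ {j u} → lo ≤ j → j ≤ n * 2 + lo → Next u (cell x j 0) → ¬ u ≡ cell x j 1 → Up j
    enterBottom {j} lo≤j j≤ n ≢ with column-edge j 0 (inside lo≤j j≤ (s≤s z≤n))
    ... | inj₁ m = climbs lo≤j j≤ m
    ... | inj₂ m = ⊥-elim (≢ (injective n m))

    enterTop : ∀ {j u} → lo ≤ j → j ≤ n * 2 + lo → Next u (cell x j (suc T)) → ¬ u ≡ cell x j T → Down j
    enterTop {j} lo≤j j≤ n ≢ with column-edge j T (inside lo≤j j≤ ≤-refl)
    ... | inj₂ m = falls lo≤j j≤ m
    ... | inj₁ m = ⊥-elim (≢ (injective n m))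

    leaves-up : ∀ {j k w} → k ≤ suc T → Up j → Next (cell x j k) w → Neighbours (cell x j k) w → k ≡ suc T
    leaves-up {j} {k} k≤ U n nb with m≤n⇒m<n∨m≡n k≤
    ... | inj₂ k≡ = k≡
    ... | inj₁ k< = ⊥-elim (¬up {j} {k} nb (functional n (U k<)))

    leaves-down : ∀ {j k w} → k ≤ suc T → Down j → Next (cell x j k) w → Neighbours (cell x j k) w → k ≡ 0
    leaves-down {k = zero} _ _ _ _ = refl
    leaves-down {j} {suc k} k≤ D n nb = ⊥-elim (¬down {j} {k} nb (functional n (D k≤)))

    vertical : ∀ {j k w} → lo ≤ j → j ≤ n * 2 + lo → Next (cell x j k) w →
      w ≡ cell x j k + x ⊎ cell x j k ≡ w + x → ∃ λ l → l ≤ suc T × w ≡ cell x j l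
    vertical {j} {k} lo≤j j≤ nx (inj₁ w≡) = suc k , outside lo≤j j≤ (subst (_< N) w≡′ (bounded nx)) , w≡′
      where
      w≡′ = trans w≡ (sym (cell-suc j k))
    -- A column of index `x` is allowed; below its bottom cell lies only 0, which has no
    -- predecessor.
    vertical {j} {zero} {w} lo≤j j≤ nx (inj₂ ≡w) = ⊥-elim (initial (subst (Next _) w≡0 nx))
      where
      w≡0 : w ≡ 0
      w≡0 = n≤0⇒n≡0 (+-cancelʳ-≤ x w 0 (≤-trans (≤-reflexive (trans (sym ≡w) (+-identityʳ j))) (≤-trans j≤ hi≤x)))
    vertical {j} {suc k} {w} lo≤j j≤ nx (inj₂ ≡w) = k , outside lo≤j j≤ (subst (_< N) w≡′ (bounded nx)) , w≡′
      where
      w≡′ : w ≡ cell x j k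
      w≡′ = sym (+-cancelʳ-≡ x (cell x j k) w (trans (sym (cell-suc j k)) ≡w))

    -- An upward column is left sideways only at its top, a downward one only at its bottom. The
    -- neighbours there are inside, apart from the two excluded exits.
    closed : ∀ {u w} → Next u w → Visited u → Visited w
    closed nx vis with lengths nx
    closed nx (up {e} {k} e≤n k≤ U) | inj₂ v with vertical {L e} {k} (lo≤L e) (L≤ e≤n) nx v
    ... | l , l≤ , refl = up e≤n l≤ U
    closed nx (down {e} {k} e<n k≤ D) | inj₂ v with vertical {suc (L e)} {k} (m≤n⇒m≤1+n (lo≤L e)) (1+L≤ e<n) nx v
    ... | l , l≤ , refl = down e<n l≤ D
    closed nx (up {e} {k} e≤n k≤ U) | inj₁ nb with leaves-up k≤ U nx nb
    closed nx (up {e} e≤n k≤ U) | inj₁ nb@(inj₁ refl) | refl with m≤n⇒m<n∨m≡n e≤n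
    ... | inj₁ e<n = down e<n k≤ (enterTop (m≤n⇒m≤1+n (lo≤L e)) (1+L≤ e<n) nx (¬from-below {suc (L e)} {T} nb))
    ... | inj₂ refl = ⊥-elim (rightExit nx)
    closed nx (up {zero} e≤n k≤ U) | inj₁ nb@(inj₂ eq) | refl = ⊥-elim (leftExit nx eq)
    closed nx (up {suc e} e≤n k≤ U) | inj₁ nb@(inj₂ refl) | refl =
      down e≤n k≤ (enterTop (m≤n⇒m≤1+n (lo≤L e)) (1+L≤ e≤n) nx (¬from-below {suc (L e)} {T} nb))
    closed nx (down {e} {k} e<n k≤ D) | inj₁ nb with leaves-down k≤ D nx nb
    closed nx (down {e} e<n k≤ D) | inj₁ nb@(inj₁ refl) | refl =
      up {suc e} e<n z≤n (enterBottom {L (suc e)} (lo≤L (suc e)) (L≤ e<n) nx (¬from-above {L (suc e)} {0} nb))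
    closed nx (down {e} e<n k≤ D) | inj₁ nb@(inj₂ refl) | refl =
      up {e} (<⇒≤ e<n) z≤n (enterBottom {L e} (lo≤L e) (L≤ (<⇒≤ e<n)) nx (¬from-above {L e} {0} nb))

    visited-bottom : ∀ {w} → Visited w → w < x → lo ≤ w × w ≤ n * 2 + lo
    visited-bottom (up {e} {zero} e≤n _ _) _ = subst (λ w → lo ≤ w × w ≤ n * 2 + lo) (sym (+-identityʳ (L e))) (lo≤L e , L≤ e≤n)
    visited-bottom (up {e} {suc k} _ _ _) lt = ⊥-elim (<⇒≱ lt (≤-trans (m≤m+n x (k * x)) (m≤n+m (x + k * x) (L e))))
    visited-bottom (down {e} {zero} e<n _ _) _ = subst (λ w → lo ≤ w × w ≤ n * 2 + lo) (sym (+-identityʳ (suc (L e)))) (m≤n⇒m≤1+n (lo≤L e) , 1+L≤ e<n)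
    visited-bottom (down {e} {suc k} _ _ _) lt = ⊥-elim (<⇒≱ lt (≤-trans (m≤m+n x (k * x)) (m≤n+m (x + k * x) (suc (L e)))))

module _ {x : ℕ} (n j T : ℕ) (x≡ : x ≡ n * 2 + (3 + j * 2)) (r<x : 3 + j * 2 < x)
  (S : Succession x (3 + j * 2 + (2 + T) * x)) where
  open Succession S

  private
    r = 3 + j * 2
    q = 2 + T
    2≤x : 2 ≤ x
    2≤x = ≤-trans (s≤s (s≤s z≤n)) (<⇒≤ r<x)
    nonempty : x < r + q * x
    nonempty = ≤-trans (s≤s (m≤m+n x ((1 + T) * x))) (s≤s (m≤n+m (q * x) (2 + j * 2)))

  -- The `r` tall columns form a rectangle of odd width whose right top corner is the largest
  -- vertex. Unless the path steps from the top of column 0 to the vertex just before it, it is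
  -- trapped there from the start and misses `r`.
  module Left (turnsRight : ∀ {w} → Next (cell x 0 q) w → ¬ cell x 0 q ≡ suc w) where

    hi≡ : (1 + j) * 2 + 0 ≡ 2 + j * 2
    hi≡ = +-identityʳ (2 + j * 2)

    open Rectangle 2≤x S 0 (1 + j) (1 + T)
      (≤-trans (≤-reflexive hi≡) (≤-trans (n≤1+n (2 + j * 2)) (<⇒≤ r<x)))
      (λ _ c≤ k≤ → +-mono-<-≤ (s≤s (≤-trans c≤ (≤-reflexive hi≡))) (*-monoˡ-≤ x k≤))
      (λ {c} {k} _ _ lt → s≤s⁻¹ (*-cancelʳ-< x k (suc q)
        (≤-trans (s≤s (m≤n+m (k * x) c)) (≤-trans lt (+-monoˡ-≤ (q * x) (<⇒≤ r<x))))))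
      (λ nx → n≮n _ (subst (λ c → suc (c + q * x) < r + q * x) hi≡ (bounded nx)))
      turnsRight

    start : Visited 0
    start with saturated 0 nonempty
    ... | inj₂ nx = ⊥-elim (initial nx)
    ... | inj₁ nx = up {0} {0} z≤n z≤n (climbs z≤n z≤n (subst (Next 0) (sym (+-identityʳ x)) nx))

    impossible : ⊥
    impossible = n≮n (2 + j * 2) (≤-trans (proj₂ (visited-bottom (induction Visited start closed {r} r<N) r<x)) (≤-reflexive hi≡))
      where
      r<N : r < r + q * x
      r<N = m<m+n r (≤-trans (s≤s z≤n) (≤-trans 2≤x (m≤m+n x ((1 + T) * x))))

  -- Otherwise the trap consists of the low columns and column `x`, which is column 0 without its
  -- bottom cell: again an odd width. The path enters it with its first step, from 0 to `x`, and
  -- misses 1.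
  module Right {w} (turnsLeft : Next (cell x 0 q) w) (q≡ : cell x 0 q ≡ suc w) where

    leftExit : ∀ {w} → Next (cell x r (suc T)) w → ¬ cell x r (suc T) ≡ suc w
    -- The cell to the left lies in a taller column and has cells above and below it; both vertical
    -- pairs are edges, so no horizontal edge can end there.
    leftExit nx refl with column-edge 2≤x S (2 + j * 2) (suc T) ≤-refl
    ... | inj₂ m = ¬from-above 2≤x S {2 + j * 2} {suc T} (inj₂ refl) (injective nx m)
    ... | inj₁ m with column-edge 2≤x S (2 + j * 2) T (+-monoʳ-≤ (3 + j * 2) (m≤n+m (suc T * x) x))
    ...   | inj₁ m′ = ¬from-below 2≤x S {2 + j * 2} {T} (inj₂ refl) (injective nx m′)
    ...   | inj₂ m′ = skip 2≤x S (2 + j * 2) T (functional m′ m)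

    open Rectangle 2≤x S r n T (≤-reflexive (sym x≡))
      (λ {c} {k} _ c≤ k≤ → ≤-trans (s≤s (+-mono-≤ (≤-trans c≤ (≤-reflexive (sym x≡))) (*-monoˡ-≤ x k≤))) (s≤s (m≤n+m (q * x) (2 + j * 2))))
      (λ {c} {k} r≤c _ lt → s≤s⁻¹ (*-cancelʳ-< x k q (+-cancelˡ-< r (k * x) (q * x) (≤-<-trans (+-monoˡ-≤ (k * x) r≤c) lt))))
      (λ nx → m≢1+m+n w {1} (trans (functional turnsLeft (subst (λ c → Next (c + suc T * x) (suc (c + suc T * x))) (sym x≡) nx))
        (cong suc (trans q≡ (+-comm 1 w)))))
      leftExit

    VisitedOr0 : ℕ → Set
    VisitedOr0 w = w ≡ 0 ⊎ Visited w

    closed₀ : ∀ {u w} → Next u w → VisitedOr0 u → VisitedOr0 w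
    closed₀ nx (inj₂ v) = inj₂ (closed nx v)
    closed₀ nx (inj₁ refl) with saturated 0 nonempty
    ... | inj₂ m = ⊥-elim (initial m)
    ... | inj₁ m with functional nx m
    ...   | refl = inj₂ (subst Visited (trans (+-identityʳ (L n)) (sym x≡)) (up {n} {0} ≤-refl z≤n
            (enterBottom (lo≤L n) ≤-refl (subst (Next 0) (sym (trans (+-identityʳ (L n)) (sym x≡))) m)
            (<⇒≢ (≤-trans (s≤s z≤n) (≤-trans (lo≤L n) (m≤m+n (L n) (1 * x))))))))

    impossible : ⊥
    impossible with induction VisitedOr0 (inj₁ refl) closed₀ {1} (≤-trans 2≤x (<⇒≤ nonempty))
    ... | inj₂ v with visited-bottom v 2≤x
    ...   | s≤s () , _

  no-succession : ⊥
  no-succession = Left.impossible Right.impossible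

-- Hamiltonian paths as lists

remove : ∀ {z u : ℕ} ys {zs} → z ∈ ys ++ u ∷ zs → ¬ z ≡ u → z ∈ ys ++ zs
remove ys z∈ z≢u with ∈-++⁻ ys z∈
... | inj₁ z∈ys         = ∈-++⁺ˡ z∈ys
... | inj₂ (here z≡u)   = ⊥-elim (z≢u z≡u)
... | inj₂ (there z∈zs) = ∈-++⁺ʳ ys z∈zs

unique-length : ∀ {L M : List ℕ} → Unique L → (∀ {z} → z ∈ L → z ∈ M) → length L ≤ length M
unique-length [] _ = z≤n
unique-length {u ∷ L} (u∉ ∷ unique) sub with ∈-∃++ (sub (here refl))
... | ys , zs , refl = ≤-trans (s≤s (unique-length unique
        (λ z∈ → remove ys (sub (there z∈)) (λ { refl → All¬⇒¬Any u∉ z∈ }))))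
    (≤-reflexive (↭-length (↭-sym (shift u ys zs))))

private variable
  p : List ℕ
  u u′ w w′ z : ℕ

data Next : List ℕ → ℕ → ℕ → Set where
  here  : ∀ {u w p} → Next (u ∷ w ∷ p) u w
  there : ∀ {u w z p} → Next p u w → Next (z ∷ p) u w

source∈ : Next p u w → u ∈ p
source∈ here      = here refl
source∈ (there n) = there (source∈ n)

target∈ : Next (z ∷ p) u w → w ∈ p
target∈ here                = here refl
target∈ (there {p = _ ∷ _} n) = there (target∈ n)

target∈′ : Next p u w → w ∈ p
target∈′ {p = _ ∷ _} n = there (target∈ n)

next-functional : Unique p → Next p u w → Next p u w′ → w ≡ w′
next-functional _         here      here      = refl
next-functional (u∉ ∷ _)  here      (there m) = ⊥-elim (All¬⇒¬Any u∉ (source∈ m))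
next-functional (u∉ ∷ _)  (there n) here      = ⊥-elim (All¬⇒¬Any u∉ (source∈ n))
next-functional (_ ∷ uniq) (there n) (there m) = next-functional uniq n m

next-injective : Unique p → Next p u w → Next p u′ w → u ≡ u′
next-injective _               here      here      = refl
next-injective (_ ∷ w∉ ∷ _)    here      (there m) = ⊥-elim (All¬⇒¬Any w∉ (target∈ m))
next-injective (_ ∷ w∉ ∷ _)    (there n) here      = ⊥-elim (All¬⇒¬Any w∉ (target∈ n))
next-injective (_ ∷ uniq)      (there n) (there m) = next-injective uniq n m

next-edge : Next p u w → ∣ u - w ∣ ∈ edgeLengths p
next-edge here = here refl
next-edge {p = _ ∷ _ ∷ _} (there n) = there (next-edge n)

next-induction : (P : ℕ → Set) → P z → (∀ {u w} → Next (z ∷ p) u w → P u → P w) → w ∈ z ∷ p → P w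
next-induction P pz step (here refl) = pz
next-induction {p = _ ∷ _} P pz step (there w∈) = next-induction P (step here pz) (λ n → step (there n)) w∈

consIf : ∀ {P : Set} → Dec P → ℕ → List ℕ → List ℕ
consIf (yes _) u p = u ∷ p
consIf (no _)  u p = p

∈-consIf : ∀ {P : Set} (P? : Dec P) → w ∈ consIf P? u p → P × w ≡ u ⊎ w ∈ p
∈-consIf (yes h) (here w≡u) = inj₁ (h , w≡u)
∈-consIf (yes _) (there w∈) = inj₂ w∈
∈-consIf (no _)  w∈         = inj₂ w∈

consIf-unique : ∀ {P : Set} (P? : Dec P) → (P → u ∉ p) → Unique p → Unique (consIf P? u p)
consIf-unique (yes h) u∉ uniq = ¬Any⇒All¬ _ (u∉ h) ∷ uniq
consIf-unique (no _)  u∉ uniq = uniq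

-- Recording an edge of length `x` by its smaller end, which lies below `v - x`, lets these edges be
-- counted against all pairs at distance `x`.
lowerEnds : ℕ → List ℕ → List ℕ
lowerEnds x []          = []
lowerEnds x (u ∷ [])    = []
lowerEnds x (u ∷ w ∷ p) = consIf (∣ u - w ∣ ≟ x) (u ⊓ w) (lowerEnds x (w ∷ p))

length-lowerEnds : ∀ x p → length (lowerEnds x p) ≡ length (filter (_≟ x) (edgeLengths p))
length-lowerEnds x []          = refl
length-lowerEnds x (u ∷ [])    = refl
length-lowerEnds x (u ∷ w ∷ p) with ∣ u - w ∣ ≟ x | length-lowerEnds x (w ∷ p)
... | yes d | ih = trans (cong suc ih) (sym (cong length (filter-accept (_≟ x) d)))
... | no d  | ih = trans ih (sym (cong length (filter-reject (_≟ x) d)))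

distance : ∀ {x} u w → ∣ u - w ∣ ≡ x → w ≡ u + x ⊎ u ≡ w + x
distance u w refl with ≤-total u w
... | inj₁ u≤w = inj₁ (trans (sym (m+[n∸m]≡n u≤w)) (cong (u +_) (sym (m≤n⇒∣m-n∣≡n∸m u≤w))))
... | inj₂ w≤u = inj₂ (trans (sym (m+[n∸m]≡n w≤u)) (cong (w +_) (sym (m≤n⇒∣n-m∣≡n∸m w≤u))))

lowerEnds-edge : ∀ {x l} p → l ∈ lowerEnds x p → Next p l (l + x) ⊎ Next p (l + x) l
lowerEnds-edge {x} (u ∷ w ∷ p) l∈ =
  [ (λ { (d , refl) → first d }) , (λ l∈ → Sum.map there there (lowerEnds-edge (w ∷ p) l∈)) ]′ (∈-consIf (∣ u - w ∣ ≟ x) l∈)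
  where
  first : ∣ u - w ∣ ≡ x → Next (u ∷ w ∷ p) (u ⊓ w) (u ⊓ w + x) ⊎ Next (u ∷ w ∷ p) (u ⊓ w + x) (u ⊓ w)
  first d with distance u w d
  ... | inj₁ refl rewrite m≤n⇒m⊓n≡m (m≤m+n u x) = inj₁ here
  ... | inj₂ refl rewrite m≥n⇒m⊓n≡n (m≤m+n w x) = inj₂ here

lowerEnds-∈ : ∀ {x l} p → l ∈ lowerEnds x p → l ∈ p × l + x ∈ p
lowerEnds-∈ p l∈ with lowerEnds-edge p l∈
... | inj₁ n = source∈ n , target∈′ n
... | inj₂ n = target∈′ n , source∈ n

-- A repeated lower end `l` would put both `l` and `l + x` into the rest of the path, but one of
-- them is `u`.
lowerEnds-unique : ∀ x → Unique p → Unique (lowerEnds x p)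
lowerEnds-unique {[]}        x _ = []
lowerEnds-unique {u ∷ []}    x _ = []
lowerEnds-unique {u ∷ w ∷ p} x (u∉ ∷ uniq) = consIf-unique (∣ u - w ∣ ≟ x) fresh (lowerEnds-unique x uniq)
  where
  fresh : ∣ u - w ∣ ≡ x → u ⊓ w ∉ lowerEnds x (w ∷ p)
  fresh d l∈ with distance u w d
  ... | inj₁ refl rewrite m≤n⇒m⊓n≡m (m≤m+n u x) = All¬⇒¬Any u∉ (proj₁ (lowerEnds-∈ (w ∷ p) l∈))
  ... | inj₂ refl rewrite m≥n⇒m⊓n≡n (m≤m+n w x) = All¬⇒¬Any u∉ (proj₂ (lowerEnds-∈ (w ∷ p) l∈))

length-oneZ : ∀ a x D → length (oneZ a x D) ≡ a + D
length-oneZ a x D = trans (length-++ (replicate a 1)) (cong₂ _+_ (length-replicate a) (length-replicate D))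

module _ {a x D : ℕ} (2≤x : 2 ≤ x) (real : HasStdLinReal (oneZ a x D)) where

  path : List ℕ
  path = 0 ∷ proj₁ real

  v : ℕ
  v = suc (a + D)

  path↭ : path ↭ upTo v
  path↭ = subst (λ n → path ↭ upTo (suc n)) (length-oneZ a x D) (proj₁ (proj₂ real))

  path-unique : Unique path
  path-unique = SetoidPermutation.Unique-resp-↭ (setoid ℕ) (↭⇒↭ₛ (↭-sym path↭)) (upTo⁺ v)

  path-< : u ∈ path → u < v
  path-< u∈ = ∈-upTo⁻ (∈-resp-↭ path↭ u∈)

  length-path-lowerEnds : length (lowerEnds x path) ≡ D
  length-path-lowerEnds = trans (length-lowerEnds x path)
    (trans (↭-length (filter-↭ (_≟ x) (proj₂ (proj₂ real)))) (trans (cong length filtered) (length-replicate D)))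
    where
    filtered : filter (_≟ x) (oneZ a x D) ≡ replicate D x
    filtered = trans (filter-++ (_≟ x) (replicate a 1) (replicate D x))
      (cong₂ _++_ (filter-none (_≟ x) (replicate⁺ a (λ 1≡x → <-irrefl 1≡x 2≤x))) (filter-all (_≟ x) (replicate⁺ D refl)))

  lowerEnds-< : u ∈ lowerEnds x path → u < v ∸ x
  lowerEnds-< {u} u∈ = m+n≤o⇒m≤o∸n (suc u) (path-< (proj₂ (lowerEnds-∈ path u∈)))

  length-upTo-v∸x : ∀ L → Unique L → (∀ {z} → z ∈ L → z < v ∸ x) → length L ≤ v ∸ x
  length-upTo-v∸x L uniq bound = ≤-trans (unique-length uniq (λ z∈ → ∈-upTo⁺ (bound z∈))) (≤-reflexive (length-upTo (v ∸ x)))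

  D≤v∸x : D ≤ v ∸ x
  D≤v∸x = ≤-trans (≤-reflexive (sym length-path-lowerEnds)) (length-upTo-v∸x _ (lowerEnds-unique x path-unique) lowerEnds-<)

  -- There are `v - x` pairs at distance `x`, `D` of them are edges, and `v = a + D + 1`. The
  -- premise excludes `v ≤ x`, where the subtraction is truncated.
  ones-needed : 1 ≤ D → x ≤ suc a
  ones-needed 1≤D with ≤-total x v
  ... | inj₂ v≤x = ⊥-elim (n≮n 0 (≤-trans 1≤D (≤-trans D≤v∸x (≤-reflexive (m≤n⇒m∸n≡0 v≤x)))))
  ... | inj₁ x≤v = +-cancelˡ-≤ D x (suc a) (≤-trans (m≤o∸n⇒m+n≤o D x≤v D≤v∸x) (≤-reflexive (trans (cong suc (+-comm a D)) (sym (+-suc D a)))))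

  -- Now `v - x = D`, so a missing pair would give `D + 1` distinct numbers below `D`.
  saturation : x ≡ suc a → ∀ u → u + x < v → Next path u (u + x) ⊎ Next path (u + x) u
  saturation refl u u+x<v with u ∈? lowerEnds x path
  ... | yes u∈ = lowerEnds-edge path u∈
  ... | no u∉  = ⊥-elim (n≮n D (≤-trans (≤-reflexive (cong suc (sym length-path-lowerEnds)))
        (≤-trans (length-upTo-v∸x (u ∷ lowerEnds x path) (¬Any⇒All¬ _ u∉ ∷ lowerEnds-unique x path-unique)
          λ { (here refl) → m+n≤o⇒m≤o∸n (suc u) u+x<v ; (there z∈) → lowerEnds-< z∈ })
        (≤-reflexive (m+n∸m≡n a D)))))

  edge-lengths : Next path u w → ∣ u - w ∣ ≡ 1 ⊎ ∣ u - w ∣ ≡ x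
  edge-lengths n with ∈-++⁻ (replicate a 1) (∈-resp-↭ (proj₂ (proj₂ real)) (next-edge n))
  ... | inj₁ e∈ = inj₁ (All.lookup {P = _≡ 1} (replicate⁺ a refl) e∈)
  ... | inj₂ e∈ = inj₂ (All.lookup {P = _≡ x} (replicate⁺ D refl) e∈)

  succession : x ≡ suc a → Succession x v
  succession x≡ = record
    { Next       = Next path
    ; functional = next-functional path-unique
    ; injective  = next-injective path-unique
    ; initial    = λ n → initial path-unique n
    ; bounded    = λ n → path-< (target∈′ n)
    ; lengths    = lengths
    ; saturated  = saturation x≡
    ; induction  = λ P p₀ step w<v → next-induction P p₀ step (∈-resp-↭ (↭-sym path↭) (∈-upTo⁺ w<v))
    }
    where
    initial : Unique (z ∷ p) → ¬ Next (z ∷ p) u z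
    initial (z∉ ∷ _) n = All¬⇒¬Any z∉ (target∈ n)
    lengths : Next path u w → Neighbours u w ⊎ (w ≡ u + x ⊎ u ≡ w + x)
    lengths {u} {w} n with edge-lengths n
    ... | inj₂ d = inj₂ (distance u w d)
    ... | inj₁ d with distance u w d
    ...   | inj₁ w≡ = inj₁ (inj₁ (trans w≡ (+-comm u 1)))
    ...   | inj₂ u≡ = inj₁ (inj₂ (trans u≡ (+-comm w 1)))

no-tight-realization : ∀ {k j T D} → let x = 3 + k * 2 in 3 + j * 2 < x → D ≡ 3 + j * 2 + (1 + T) * x →
  ¬ HasStdLinReal (oneZ (2 + k * 2) x D)
no-tight-realization {k} {j} {T} ρ<x refl real with gap (<⇒≤ (half-< j k (+-cancelˡ-< 3 (j * 2) (k * 2) ρ<x)))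
... | d , refl = no-succession d j T (e d j) ρ<x
    (subst (Succession x) (e′ x (j * 2) T) (succession (s≤s (s≤s z≤n)) real refl))
  where
  x = 3 + (d + j) * 2
  e : ∀ d j → 3 + (d + j) * 2 ≡ d * 2 + (3 + j * 2)
  e = solve-∀
  e′ : ∀ x n T → x + (3 + n + (1 + T) * x) ≡ 3 + n + (2 + T) * x
  e′ = solve-∀

-- Assembling the theorem

module Final (k t a b c : ℕ) (2≤t : 2 ≤ t) (size : (t + 2) * (3 + k * 2) ≤ a + b + c + 1)
  (ω≤a : ∀ w → IsOmega (3 + k * 2) (b + c) w → w ≤ a)
  (many : 2 * ((a + b + c + 1) / (3 + k * 2)) + t * (3 + k * 2) + 1 ≤ b + 2 * t) where

  x D Q ρ : ℕ
  x = 3 + k * 2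
  D = b + c
  Q = D / x
  ρ = D % x

  D≡ : D ≡ ρ + Q * x
  D≡ = m≡m%n+[m/n]*n D x

  ρ<x : ρ < x
  ρ<x = m%n<n D x

  quotient-≥ : ∀ m {n} → m * x ≤ n → m ≤ n / x
  quotient-≥ m {n} le = subst (_≤ n / x) (m*n/n≡m m x) (/-monoˡ-≤ x le)

  -- The size bound gives `q ≥ t + 2`, and the premise on `b` then gives `b ≥ t * x + 5`.
  x≤D : x ≤ D
  x≤D = cancel-≤ (2 * t) ((t ∸ 1) * x + 5) (e t x 2≤t) refl
    (≤-trans (+-monoˡ-≤ 1 (+-monoˡ-≤ (t * x) (*-monoʳ-≤ 2 (quotient-≥ (t + 2) size))))
      (≤-trans many (+-monoˡ-≤ (2 * t) (m≤m+n b c))))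
    where
    e : ∀ t x → 2 ≤ t → 2 * (t + 2) + t * x + 1 ≡ x + 2 * t + ((t ∸ 1) * x + 5)
    e (suc t) x _ = e′ t x
      where
      e′ : ∀ t x → 2 * (1 + t + 2) + (1 + t) * x + 1 ≡ x + 2 * (1 + t) + (t * x + 5)
      e′ = solve-∀

  1≤Q : 1 ≤ Q
  1≤Q = quotient-≥ 1 (≤-trans (≤-reflexive (*-identityˡ x)) x≤D)

  -- The construction is used twice. Without long edges it realizes `{1^w, x^D}`, so by `optimal`
  -- `w` is `ω(x, D)` and hence at most `a`. With the given `t` and `c` it gives the path, once the
  -- `a - w` spare edges of length 1 are put in front.
  assemble : ∀ w → x ≤ suc w →
    (∀ t g c → 1 ≤ t → Q ≡ g + t → Room x g ρ c → Std x (t * x) (suc (w + D)) w c) →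
    (∀ a′ → a′ < w → ¬ HasStdLinReal (oneZ a′ x D)) →
    HasStdLinReal (edgeList x (t * x) a b c)
  assemble w x≤1+w build optimal with gap w≤a
    where
    w-real : HasStdLinReal (oneZ w x D)
    w-real = subst (λ l → HasStdLinReal (replicate w 1 ++ l)) (++-identityʳ (replicate D x))
      (realize {c = 0} (cong suc (sym (+-identityʳ (w + D))))
        -- With no long edges to place, `t = 1` will do, as `1 ≤ Q`.
        (build 1 (Q ∸ 1) 0 ≤-refl (sym (m∸n+n≡m 1≤Q)) (λ _ _ → z≤n)))
    w≤a : w ≤ a
    w≤a = ω≤a w (w-real , optimal)
  ... | d , refl = realize (e d w b c) (prepend-ones d (build t g c (≤-trans (s≤s z≤n) 2≤t) Q≡ (budget-room x t g ρ c (subst (λ Q → Budget x t Q ρ c) Q≡ budget))))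
    where
    e : ∀ d w b c → d + suc (w + (b + c)) ≡ suc (d + w + b + c)
    e = solve-∀
    columns : 1 + Q ≤ (d + w + b + c + 1) / x
    -- The number of vertices is at least `(1 + w) + D ≥ x + Q * x`.
    columns = quotient-≥ (1 + Q) (≤-trans (+-mono-≤ x≤1+w (≤-trans (m≤n+m (Q * x) ρ) (≤-reflexive (sym D≡))))
      (≤-trans (m≤n+m _ d) (≤-reflexive (trans (e d w b c) (+-comm 1 (d + w + b + c))))))
    budget : Budget x t Q ρ c
    budget = ≤-trans (+-monoˡ-≤ c (≤-trans (+-monoˡ-≤ 1 (+-monoˡ-≤ (t * x) (*-monoʳ-≤ 2 columns))) many))
      (≤-reflexive (trans (e₂ b t c) (cong (_+ 2 * t) D≡)))
      where
      e₂ : ∀ b t c → b + 2 * t + c ≡ b + c + 2 * t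
      e₂ = solve-∀
    g = Q ∸ t
    Q≡ : Q ≡ g + t
    Q≡ = sym (m∸n+n≡m (t≤Q x t Q ρ c (s≤s (s≤s z≤n)) ρ<x budget))

  result : HasStdLinReal (edgeList x (t * x) a b c)
  result with slack-or-tight ρ
  ... | inj₁ slack = assemble (2 + k * 2) ≤-refl
    (λ t g c 1≤t Q≡ room → subst (λ N → Std x (t * x) N (2 + k * 2) c)
      (trans (cong (_+ x) (trans (cong (λ Q → ρ + Q * x) (sym Q≡)) (sym D≡))) (+-comm D x))
      (slackStd k t g ρ c 1≤t ρ<x room slack))
    (λ a′ a′<w real → <⇒≱ a′<w (s≤s⁻¹ (ones-needed (s≤s (s≤s z≤n)) real (≤-trans (s≤s z≤n) x≤D))))
  ... | inj₂ tight@(j , ρ≡) = assemble x (n≤1+n x)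
    (λ t g c 1≤t Q≡ room → subst (λ N → Std x (t * x) N x c)
      (cong suc (trans (cong (_+ x) (trans (cong (λ Q → ρ + Q * x) (sym Q≡)) (sym D≡))) (+-comm D x)))
      (tightStd k t g ρ c 1≤t ρ<x room tight))
    optimal
    where
    optimal : ∀ a′ → a′ < x → ¬ HasStdLinReal (oneZ a′ x D)
    optimal a′ a′<x real with ≤-antisym a′<x (ones-needed (s≤s (s≤s z≤n)) real (≤-trans (s≤s z≤n) x≤D))
    ... | refl = no-tight-realization {k} {j} {Q ∸ 1} (subst (_< x) ρ≡ ρ<x)
      (trans D≡ (cong₂ (λ ρ Q → ρ + Q * x) ρ≡ (sym (m+[n∸m]≡n 1≤Q)))) real

theorem4p3 : (x t a b c : ℕ) → .{{_ : NonZero x}} → x % 2 ≡ 1 → 1 < x → 2 ≤ t → 1 ≤ b + c →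
    (t + 2) * x ≤ a + b + c + 1 →
    (∀ w → IsOmega x (b + c) w → w ≤ a) →
    2 * ((a + b + c + 1) / x) + t * x + 1 ≤ b + 2 * t →
    HasStdLinReal (replicate a 1 ++ replicate b x ++ replicate c (t * x))
theorem4p3 x t a b c odd 1<x 2≤t _ size ω≤a many with halve x
... | j , inj₁ refl with () ← trans (sym (m*n%n≡0 j 2)) odd
... | zero , inj₂ refl = ⊥-elim (n≮n 1 1<x)
... | suc k , inj₂ refl = Final.result k t a b c 2≤t size ω≤a many
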